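{- Let $p$ be an odd prime. For $n\ge 1$ let $\mathcal{B}_n=B_n/n$, where $B_n$ is the $n$-th Bernoulli number (with $B_1=-\tfrac12$). Let $M_{p-2}$ be the number of permutations of $p-2$ letters that have an even number of ascents and are distinct from the identity. Then $$\sum_{k=1}^{p-2}\frac{\mathcal{B}_k}{2^k}\equiv\frac{p\,B_{p-1}+1}{p}+2M_{p-2}\pmod p.$$
   Context: Congruences are taken in the ring $\mathbb{Z}_p$ of $p$-adic integers: $x\equiv y \pmod{p^r}$ means $x-y\in p^r\mathbb{Z}_p$. The quantity $\frac{pB_{p-1}+1}{p}$ (the Agoh–Giuga quotient) lies in $\mathbb{Z}_p$. For a permutation $(i_1,\dots,i_n)$ of $\{1,\dots,n\}$ (mapping $j$ to $i_j$), an ascent is an index $k$ with $i_{k+1}>i_k$. -}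

module Defs where

open import Data.Bool using (Bool; true; false; if_then_else_; _∧_; not)
open import Data.Nat as ℕ using (ℕ; zero; suc; _^_)
open import Data.Nat.Combinatorics using (_C_)
open import Data.Fin using (Fin; toℕ; fromℕ)
open import Data.Fin.Properties using () renaming (_≟_ to _≟ᶠ_)
open import Data.Vec using (Vec; []; _∷_; _∷ʳ_; lookup; allFin; toList)
open import Data.Vec.Properties using (≡-dec)
open import Data.List using (List; []; _∷_)
open import Data.Integer as ℤ using (ℤ; +_)
open import Data.Integer.Divisibility using () renaming (_∣_ to _∣ℤ_)
open import Data.Rational using (ℚ; _+_; _-_; _*_; -_; _/_; ↥_)
open import Relation.Nullary.Decidable using (⌊_⌋; does)

-- ℕ → ℚ embedding and reciprocal (1/0 := 0, never used at 0 below)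
ℕ→ℚ : ℕ → ℚ
ℕ→ℚ n = (+ n) / 1

inv : ℕ → ℚ
inv zero    = (+ 0) / 1
inv (suc n) = (+ 1) / suc n

ΣFin : (n : ℕ) → (Fin n → ℚ) → ℚ
ΣFin zero    f = (+ 0) / 1
ΣFin (suc n) f = f Fin.zero + ΣFin n (λ i → f (Fin.suc i))

-- Bernoulli numbers via B_0 = 1, Σ_{k=0}^{n} C(n+1,k) B_k = 0 (n ≥ 1); gives B_1 = -1/2.
-- bernVec n = (B_0, …, B_{n-1})
bernVec : (n : ℕ) → Vec ℚ n
bernVec zero          = []
bernVec (suc zero)    = (+ 1) / 1 ∷ []
bernVec (suc (suc n)) =
  let v = bernVec (suc n) in
  v ∷ʳ (- (inv (suc (suc n)) * ΣFin (suc n) (λ k → ℕ→ℚ (suc (suc n) C toℕ k) * lookup v k)))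

bernoulli : ℕ → ℚ
bernoulli n = lookup (bernVec (suc n)) (fromℕ n)

divBernoulli : ℕ → ℚ
divBernoulli n = bernoulli n * inv n

-- congruence modulo p in ℤ_p for rationals: x - y ∈ pℤ_p, i.e. p divides the
-- numerator of the reduced fraction x - y
_≡_[modℚ_] : ℚ → ℚ → ℕ → Set
x ≡ y [modℚ p ] = (+ p) ∣ℤ (↥ (x - y))

ascents : {m : ℕ} → List (Fin m) → ℕ
ascents []            = 0
ascents (x ∷ [])      = 0
ascents (x ∷ y ∷ xs)  = (if ⌊ toℕ x ℕ.<? toℕ y ⌋ then 1 else 0) ℕ.+ ascents (y ∷ xs)

isEven : ℕ → Bool
isEven zero          = true
isEven (suc zero)    = false
isEven (suc (suc n)) = isEven n

allB : {A : Set} → (A → Bool) → List A → Bool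
allB f []       = true
allB f (x ∷ xs) = f x ∧ allB f xs

distinct : {m : ℕ} → List (Fin m) → Bool
distinct []       = true
distinct (x ∷ xs) = allB (λ y → not ⌊ x ≟ᶠ y ⌋) xs ∧ distinct xs

-- a word (i_1,…,i_m) over {1,…,m} (encoded as Fin m) is counted by M_m iff it is a
-- permutation (entries distinct), has an even number of ascents, and is not the identity
countedByM : (m : ℕ) → Vec (Fin m) m → Bool
countedByM m v = distinct (toList v) ∧ isEven (ascents (toList v))
                 ∧ not ⌊ ≡-dec _≟ᶠ_ v (allFin m) ⌋

countVec : (m n : ℕ) → (Vec (Fin m) n → Bool) → ℕ
countVec m zero    P = if P [] then 1 else 0
countVec m (suc n) P = sumF m (λ i → countVec m n (λ w → P (i ∷ w)))
  where
  sumF : (k : ℕ) → (Fin k → ℕ) → ℕ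
  sumF zero    f = 0
  sumF (suc k) f = f Fin.zero ℕ.+ sumF k (λ i → f (Fin.suc i))

M : ℕ → ℕ
M m = countVec m m (countedByM m)

agohGiuga : ℕ → ℚ
agohGiuga p = (ℕ→ℚ p * bernoulli (p ℕ.∸ 1) + (+ 1) / 1) * inv p

{-# OPTIONS --safe #-}
module Submission where

-- Put s = p - 2 and let q = (2ᵖ⁻¹ - 1)/p. The difference equation of the Bernoulli polynomials gives
-- Bₚ(-2) - Bₚ(0) = -p - p 2ᵖ⁻¹. Expand Bₚ(-2), divide by p and use C(p,k)/p ≡ (-1)ᵏ⁻¹/k: the
-- left-hand side of the theorem is ≡ Bₚ₋₁ + 1/p + q - 1. On the other side 2 M_s = s! + E_s - 2, where
-- E_n is the sum of (-1)^ascents over the permutations of n letters (so E_s counts even minus odd, and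
-- the identity is even). Here s! ≡ 1 by Wilson, and the exponential generating function satisfies
-- E(x)(e²ˣ + 1) = 2e²ˣ. Iterating this p times turns e²ᵖˣ ≡ 1 into a formula for E_s as an alternating
-- sum of powers, which is ≡ Σ C(p,k)/(2p) over 0 < k < p, i.e. ≡ q.

open import Defs
open import Relation.Binary.PropositionalEquality

-- An exponential generating function appears only as its coefficient sequence `ℕ → ℚ`, and
-- multiplication as the binomial convolution `conv`. The obstacle is division by p: 1/p and Bₚ₋₁
-- are not p-integral, so neither can be reduced. Every identity that is to be divided by p is
-- therefore proved exactly in `ℚ`, cancelled there, and only then read modulo p; the congruence
-- asks only that the difference be a multiple of p, so the two fractional terms pass through
-- untouched. The point -2 is chosen for its signs: (-1)ᵖ⁻ᵏ from the power meets (-1)ᵏ⁻¹ from the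
-- binomial coefficient, and the product is 1 for odd p. The functional equation of E needs a
-- statistic finer than n, since the ascents of a word depend on how its first letter compares with
-- the next. One prepends a fixed letter and records its rank k among the others. At t = -1 raising
-- k by one adds twice an entry of the previous row; rank n gives Eₙ, while rank 0 forces an ascent
-- and gives -Eₙ for n ≥ 1. Joining the two ends yields the equation.

module Exact where

  open import Data.Bool as Bool using (Bool; true; false; if_then_else_; _∧_; not)
  open import Data.Fin as Fin using (Fin; toℕ; fromℕ)
  open import Data.Fin.Properties as Finₚ using (toℕ-injective) renaming (_≟_ to _≟ᶠ_)
  open import Data.Integer as ℤ using (ℤ)
  import Data.Integer.Properties as ℤₚ
  open import Data.List as List using (List; []; _∷_)
  open import Data.Nat as ℕ using (ℕ; zero; suc; _<_; _∸_; z≤n; s≤s; _!)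
  open import Data.Nat.Combinatorics using (_C_; nCk+nC[k+1]≡[n+1]C[k+1]; k>n⇒nCk≡0; nCn≡1)
  import Data.Nat.Properties as ℕₚ
  open import Data.Rational using (ℚ; _+_; _-_; _*_; -_; _/_; 0ℚ; 1ℚ; toℚᵘ; ↥_; ↧ₙ_; ↧_)
  open import Data.Rational.Properties hiding (_<?_; _≟_)
  open import Data.Rational.Solver using (module +-*-Solver)
  import Data.Rational.Unnormalised as ℚᵘ
  import Data.Rational.Unnormalised.Properties as ℚᵘₚ
  open import Data.Vec using (Vec; []; _∷_; _∷ʳ_; lookup; toList; allFin; tabulate)
  open import Data.Vec.Properties using (≡-dec)
  open import Function using (_∘_; id)
  open import Relation.Nullary using (yes; no; contradiction)
  open import Relation.Nullary.Decidable using (⌊_⌋)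
  open +-*-Solver using (solve; _:+_; _:*_; :-_; _:-_; _:=_; con)
  open ≡-Reasoning

  -- Integers and reciprocals inside the rationals

  ℤ→ℚ : ℤ → ℚ
  ℤ→ℚ i = i / 1

  -- `_/_` cancels a gcd and so does not compute on variables. Its unnormalised image is the
  -- unreduced fraction, where the embedding laws below become cross-multiplications of integers.
  toℚᵘ-/ : ∀ i n → toℚᵘ (i / suc n) ℚᵘ.≃ ℚᵘ.mkℚᵘ i n
  toℚᵘ-/ i n = toℚᵘ-fromℚᵘ (ℚᵘ.mkℚᵘ i n)

  ℤ→ℚ-+ : ∀ i j → ℤ→ℚ (i ℤ.+ j) ≡ ℤ→ℚ i + ℤ→ℚ j
  ℤ→ℚ-+ i j = toℚᵘ-injective (ℚᵘₚ.≃-trans (toℚᵘ-/ (i ℤ.+ j) 0) (ℚᵘₚ.≃-sym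
    (ℚᵘₚ.≃-trans (toℚᵘ-homo-+ (i / 1) (j / 1))
    (ℚᵘₚ.≃-trans (ℚᵘₚ.+-cong (toℚᵘ-/ i 0) (toℚᵘ-/ j 0))
    (ℚᵘ.*≡* (cong (ℤ._* (ℤ.+ 1)) (cong₂ ℤ._+_ (ℤₚ.*-identityʳ i) (ℤₚ.*-identityʳ j))))))))

  ℤ→ℚ-* : ∀ i j → ℤ→ℚ (i ℤ.* j) ≡ ℤ→ℚ i * ℤ→ℚ j
  ℤ→ℚ-* i j = toℚᵘ-injective (ℚᵘₚ.≃-trans (toℚᵘ-/ (i ℤ.* j) 0) (ℚᵘₚ.≃-sym
    (ℚᵘₚ.≃-trans (toℚᵘ-homo-* (i / 1) (j / 1)) (ℚᵘₚ.*-cong (toℚᵘ-/ i 0) (toℚᵘ-/ j 0)))))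

  ℤ→ℚ-neg : ∀ i → ℤ→ℚ (ℤ.- i) ≡ - ℤ→ℚ i
  ℤ→ℚ-neg i = toℚᵘ-injective (ℚᵘₚ.≃-trans (toℚᵘ-/ (ℤ.- i) 0) (ℚᵘₚ.≃-sym
    (ℚᵘₚ.≃-trans (toℚᵘ-homo‿- (i / 1)) (ℚᵘₚ.-‿cong (toℚᵘ-/ i 0)))))

  ℤ→ℚ-injective : ∀ {i j} → ℤ→ℚ i ≡ ℤ→ℚ j → i ≡ j
  ℤ→ℚ-injective {i} {j} eq with ℚᵘₚ.≃-trans (ℚᵘₚ.≃-sym (toℚᵘ-/ i 0)) (ℚᵘₚ.≃-trans (toℚᵘ-cong eq) (toℚᵘ-/ j 0))
  ... | ℚᵘ.*≡* e = trans (sym (ℤₚ.*-identityʳ i)) (trans e (ℤₚ.*-identityʳ j))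

  ℕ→ℚ-+ : ∀ m n → ℕ→ℚ (m ℕ.+ n) ≡ ℕ→ℚ m + ℕ→ℚ n
  ℕ→ℚ-+ m n = ℤ→ℚ-+ (ℤ.+ m) (ℤ.+ n)

  ℕ→ℚ-* : ∀ m n → ℕ→ℚ (m ℕ.* n) ≡ ℕ→ℚ m * ℕ→ℚ n
  ℕ→ℚ-* m n = trans (cong ℤ→ℚ (ℤₚ.pos-* m n)) (ℤ→ℚ-* (ℤ.+ m) (ℤ.+ n))

  ℕ→ℚ-suc : ∀ n → ℕ→ℚ (suc n) ≡ 1ℚ + ℕ→ℚ n
  ℕ→ℚ-suc n = ℕ→ℚ-+ 1 n

  n*inv[n]≡1 : ∀ n → ℕ→ℚ (suc n) * inv (suc n) ≡ 1ℚ
  n*inv[n]≡1 n = toℚᵘ-injective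
    (ℚᵘₚ.≃-trans (toℚᵘ-homo-* (ℕ→ℚ (suc n)) (inv (suc n)))
    (ℚᵘₚ.≃-trans (ℚᵘₚ.*-cong (toℚᵘ-/ (ℤ.+ suc n) 0) (toℚᵘ-/ (ℤ.+ 1) n))
    (ℚᵘ.*≡* (trans (ℤₚ.*-identityʳ _) (trans (ℤₚ.*-identityʳ _) (cong ℤ.+_ (sym (trans (ℕₚ.+-identityʳ _) (ℕₚ.+-identityʳ _)))))))))

  inv-*-cancel : ∀ n x → inv (suc n) * (ℕ→ℚ (suc n) * x) ≡ x
  inv-*-cancel n x = begin
    inv (suc n) * (ℕ→ℚ (suc n) * x) ≡⟨ sym (*-assoc (inv (suc n)) (ℕ→ℚ (suc n)) x) ⟩
    inv (suc n) * ℕ→ℚ (suc n) * x ≡⟨ cong (_* x) (trans (*-comm (inv (suc n)) (ℕ→ℚ (suc n))) (n*inv[n]≡1 n)) ⟩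
    1ℚ * x ≡⟨ *-identityˡ x ⟩
    x ∎

  -- Ties the reduced numerator, in which the congruence of the theorem is phrased, to arithmetic in
  -- `ℚ`.
  x*↧x≡↥x : ∀ x → x * ℕ→ℚ (↧ₙ x) ≡ ℤ→ℚ (↥ x)
  x*↧x≡↥x x@record{} = toℚᵘ-injective
    (ℚᵘₚ.≃-trans (toℚᵘ-homo-* x (ℕ→ℚ (↧ₙ x)))
    (ℚᵘₚ.≃-trans (ℚᵘₚ.*-congˡ {toℚᵘ x} (toℚᵘ-/ (↧ x) 0))
    (ℚᵘₚ.≃-trans (ℚᵘ.*≡* (trans (ℤₚ.*-identityʳ _) (cong (↥ x ℤ.*_) (cong ℤ.+_ (sym (ℕₚ.*-identityʳ _))))))
     (ℚᵘₚ.≃-sym (toℚᵘ-/ (↥ x) 0)))))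

  -- Powers and finite sums

  infixr 8 _^ℚ_
  _^ℚ_ : ℚ → ℕ → ℚ
  x ^ℚ zero  = 1ℚ
  x ^ℚ suc n = x * x ^ℚ n

  ∑ : ℕ → (ℕ → ℚ) → ℚ
  ∑ zero    f = 0ℚ
  ∑ (suc n) f = ∑ n f + f n

  ∑-cong : ∀ n {f g} → (∀ k → k < n → f k ≡ g k) → ∑ n f ≡ ∑ n g
  ∑-cong zero    e = refl
  ∑-cong (suc n) e = cong₂ _+_ (∑-cong n (λ k k<n → e k (ℕₚ.m<n⇒m<1+n k<n))) (e n ℕₚ.≤-refl)

  ∑-+ : ∀ n f g → ∑ n (λ k → f k + g k) ≡ ∑ n f + ∑ n g
  ∑-+ zero    f g = refl
  ∑-+ (suc n) f g = trans (cong (_+ (f n + g n)) (∑-+ n f g))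
    (solve 4 (λ a b c d → (a :+ b) :+ (c :+ d) := (a :+ c) :+ (b :+ d)) refl (∑ n f) (∑ n g) (f n) (g n))

  ∑-*ˡ : ∀ n c f → ∑ n (λ k → c * f k) ≡ c * ∑ n f
  ∑-*ˡ zero    c f = sym (*-zeroʳ c)
  ∑-*ˡ (suc n) c f = trans (cong (_+ c * f n) (∑-*ˡ n c f)) (sym (*-distribˡ-+ c _ _))

  ∑-0 : ∀ n → ∑ n (λ _ → 0ℚ) ≡ 0ℚ
  ∑-0 zero    = refl
  ∑-0 (suc n) = trans (+-identityʳ _) (∑-0 n)

  ∑-head : ∀ n f → ∑ (suc n) f ≡ f 0 + ∑ n (f ∘ suc)
  ∑-head zero    f = +-comm 0ℚ (f 0)
  ∑-head (suc n) f = trans (cong (_+ f (suc n)) (∑-head n f)) (+-assoc (f 0) _ _)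

  ΣFin≡∑ : ∀ n f → ΣFin n (f ∘ toℕ) ≡ ∑ n f
  ΣFin≡∑ zero    f = refl
  ΣFin≡∑ (suc n) f = trans (cong (f 0 +_) (ΣFin≡∑ n (f ∘ suc))) (sym (∑-head n f))

  -- Products of exponential generating functions

  -- conv f g n = Σₖ C(n,k) f(k) g(n-k), defined by the Leibniz rule.
  conv : (ℕ → ℚ) → (ℕ → ℚ) → ℕ → ℚ
  conv f g zero    = f 0 * g 0
  conv f g (suc n) = conv (f ∘ suc) g n + conv f (g ∘ suc) n

  conv-cong : ∀ n {f f′ g g′} → (∀ k → f k ≡ f′ k) → (∀ k → g k ≡ g′ k) → conv f g n ≡ conv f′ g′ n
  conv-cong zero    p q = cong₂ _*_ (p 0) (q 0)
  conv-cong (suc n) p q = cong₂ _+_ (conv-cong n (p ∘ suc) q) (conv-cong n p (q ∘ suc))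

  conv-comm : ∀ n f g → conv f g n ≡ conv g f n
  conv-comm zero    f g = *-comm (f 0) (g 0)
  conv-comm (suc n) f g = trans (+-comm (conv (f ∘ suc) g n) _) (cong₂ _+_ (conv-comm n f (g ∘ suc)) (conv-comm n (f ∘ suc) g))

  conv-distribʳ : ∀ n f g h → conv (λ k → f k + g k) h n ≡ conv f h n + conv g h n
  conv-distribʳ zero    f g h = *-distribʳ-+ (h 0) (f 0) (g 0)
  conv-distribʳ (suc n) f g h = trans
    (cong₂ _+_ (conv-distribʳ n (f ∘ suc) (g ∘ suc) h) (conv-distribʳ n f g (h ∘ suc)))
    (solve 4 (λ a b c d → (a :+ b) :+ (c :+ d) := (a :+ c) :+ (b :+ d)) refl
      (conv (f ∘ suc) h n) (conv (g ∘ suc) h n) (conv f (h ∘ suc) n) (conv g (h ∘ suc) n))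

  conv-distribˡ : ∀ n f g h → conv f (λ k → g k + h k) n ≡ conv f g n + conv f h n
  conv-distribˡ n f g h = trans (conv-comm n f _) (trans (conv-distribʳ n g h f) (cong₂ _+_ (conv-comm n g f) (conv-comm n h f)))

  conv-scaleˡ : ∀ n c f g → conv (λ k → c * f k) g n ≡ c * conv f g n
  conv-scaleˡ zero    c f g = *-assoc c (f 0) (g 0)
  conv-scaleˡ (suc n) c f g = trans (cong₂ _+_ (conv-scaleˡ n c (f ∘ suc) g) (conv-scaleˡ n c f (g ∘ suc))) (sym (*-distribˡ-+ c _ _))

  conv-scaleʳ : ∀ n c f g → conv f (λ k → c * g k) n ≡ c * conv f g n
  conv-scaleʳ n c f g = trans (conv-comm n f _) (trans (conv-scaleˡ n c g f) (cong (c *_) (conv-comm n g f)))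

  conv-assoc : ∀ n f g h → conv (conv f g) h n ≡ conv f (conv g h) n
  conv-assoc zero    f g h = *-assoc (f 0) (g 0) (h 0)
  conv-assoc (suc n) f g h = begin
    conv (λ k → conv (f ∘ suc) g k + conv f (g ∘ suc) k) h n + conv (conv f g) (h ∘ suc) n
      ≡⟨ cong₂ _+_ (conv-distribʳ n (conv (f ∘ suc) g) (conv f (g ∘ suc)) h) (conv-assoc n f g (h ∘ suc)) ⟩
    conv (conv (f ∘ suc) g) h n + conv (conv f (g ∘ suc)) h n + conv f (conv g (h ∘ suc)) n
      ≡⟨ cong (_+ conv f (conv g (h ∘ suc)) n) (cong₂ _+_ (conv-assoc n (f ∘ suc) g h) (conv-assoc n f (g ∘ suc) h)) ⟩
    conv (f ∘ suc) (conv g h) n + conv f (conv (g ∘ suc) h) n + conv f (conv g (h ∘ suc)) n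
      ≡⟨ +-assoc (conv (f ∘ suc) (conv g h) n) _ _ ⟩
    conv (f ∘ suc) (conv g h) n + (conv f (conv (g ∘ suc) h) n + conv f (conv g (h ∘ suc)) n)
      ≡⟨ cong (conv (f ∘ suc) (conv g h) n +_) (sym (conv-distribˡ n f (conv (g ∘ suc) h) (conv g (h ∘ suc)))) ⟩
    conv f (conv g h) (suc n) ∎

  δ : ℕ → ℚ
  δ zero    = 1ℚ
  δ (suc n) = 0ℚ

  conv-zeroˡ : ∀ n g → conv (λ _ → 0ℚ) g n ≡ 0ℚ
  conv-zeroˡ zero    g = *-zeroˡ (g 0)
  conv-zeroˡ (suc n) g = cong₂ _+_ (conv-zeroˡ n g) (conv-zeroˡ n (g ∘ suc))

  conv-identityˡ : ∀ n g → conv δ g n ≡ g n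
  conv-identityˡ zero    g = *-identityˡ (g 0)
  conv-identityˡ (suc n) g = trans (cong₂ _+_ (conv-zeroˡ n g) (conv-identityˡ n (g ∘ suc))) (+-identityˡ (g (suc n)))

  conv-identityʳ : ∀ n f → conv f δ n ≡ f n
  conv-identityʳ n f = trans (conv-comm n f δ) (conv-identityˡ n f)

  -- `x ^ℚ_` holds the coefficients of the exponential series of xz, so the binomial theorem is the
  -- law of exponents here.
  conv-exp : ∀ n x y → conv (x ^ℚ_) (y ^ℚ_) n ≡ (x + y) ^ℚ n
  conv-exp zero    x y = refl
  conv-exp (suc n) x y = begin
    conv (λ k → x * x ^ℚ k) (y ^ℚ_) n + conv (x ^ℚ_) (λ k → y * y ^ℚ k) n
      ≡⟨ cong₂ _+_ (conv-scaleˡ n x (x ^ℚ_) (y ^ℚ_)) (conv-scaleʳ n y (x ^ℚ_) (y ^ℚ_)) ⟩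
    x * conv (x ^ℚ_) (y ^ℚ_) n + y * conv (x ^ℚ_) (y ^ℚ_) n
      ≡⟨ sym (*-distribʳ-+ (conv (x ^ℚ_) (y ^ℚ_) n) x y) ⟩
    (x + y) * conv (x ^ℚ_) (y ^ℚ_) n
      ≡⟨ cong ((x + y) *_) (conv-exp n x y) ⟩
    (x + y) * (x + y) ^ℚ n ∎

  -- Binomial coefficients

  binom : ℕ → ℕ → ℚ
  binom n k = ℕ→ℚ (n C k)

  binom-pascal : ∀ n k → binom (suc n) (suc k) ≡ binom n k + binom n (suc k)
  binom-pascal n k = trans (cong ℕ→ℚ (sym (nCk+nC[k+1]≡[n+1]C[k+1] n k))) (ℕ→ℚ-+ (n C k) (n C suc k))

  binom-n-0 : ∀ n → binom n 0 ≡ 1ℚ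
  binom-n-0 zero = refl
  binom-n-0 (suc n) = cong ℕ→ℚ {suc n C 0} {1} refl

  binom-n-n : ∀ n → binom n n ≡ 1ℚ
  binom-n-n n = cong ℕ→ℚ (nCn≡1 n)

  binom-> : ∀ {n k} → n < k → binom n k ≡ 0ℚ
  binom-> n<k = cong ℕ→ℚ (k>n⇒nCk≡0 n<k)

  -- Pascal's rule matches the two halves of the Leibniz recursion. The recursive form serves the
  -- algebraic laws, this explicit form the places where single terms are split off.
  conv≡∑ : ∀ n f g → conv f g n ≡ ∑ (suc n) (λ k → binom n k * (f k * g (n ∸ k)))
  conv≡∑ zero    f g = solve 1 (λ a → a := con 0ℚ :+ con 1ℚ :* a) refl (f 0 * g 0)
  conv≡∑ (suc n) f g = sym (begin
    ∑ (suc (suc n)) (λ k → binom (suc n) k * (f k * g (suc n ∸ k)))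
      ≡⟨ ∑-head (suc n) (λ k → binom (suc n) k * (f k * g (suc n ∸ k))) ⟩
    binom (suc n) 0 * (f 0 * g (suc n)) + ∑ (suc n) (λ k → binom (suc n) (suc k) * (f (suc k) * g (n ∸ k)))
      ≡⟨ cong₂ _+_ (cong (_* (f 0 * g (suc n))) (trans (binom-n-0 (suc n)) (sym (binom-n-0 n))))
           (trans (∑-cong (suc n) (λ k _ → trans (cong (_* (f (suc k) * g (n ∸ k))) (binom-pascal n k))
                                        (*-distribʳ-+ (f (suc k) * g (n ∸ k)) (binom n k) (binom n (suc k)))))
             (∑-+ (suc n) (λ k → binom n k * (f (suc k) * g (n ∸ k))) (λ k → binom n (suc k) * (f (suc k) * g (n ∸ k))))) ⟩
    h 0 + (A + ∑ (suc n) (h ∘ suc))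
      ≡⟨ solve 3 (λ a b c → a :+ (b :+ c) := b :+ (a :+ c)) refl (h 0) A (∑ (suc n) (h ∘ suc)) ⟩
    A + (h 0 + ∑ (suc n) (h ∘ suc))
      ≡⟨ cong (A +_) (sym (∑-head (suc n) h)) ⟩
    A + (∑ (suc n) h + h (suc n))
      -- C(n,n+1) = 0 removes the surplus last term.
      ≡⟨ cong (λ z → A + (∑ (suc n) h + z)) (trans (cong (_* (f (suc n) * g (suc n ∸ suc n))) (binom-> {n} ℕₚ.≤-refl)) (*-zeroˡ (f (suc n) * g (suc n ∸ suc n)))) ⟩
    A + (∑ (suc n) h + 0ℚ)
      ≡⟨ cong (A +_) (+-identityʳ (∑ (suc n) h)) ⟩
    A + ∑ (suc n) h
      ≡⟨ cong₂ _+_ (sym (conv≡∑ n (f ∘ suc) g))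
          (trans (∑-cong (suc n) (λ k k≤n → cong (λ j → binom n k * (f k * g j)) (ℕₚ.+-∸-assoc 1 (ℕₚ.≤-pred k≤n))))
                 (sym (conv≡∑ n f (g ∘ suc)))) ⟩
    conv f g (suc n) ∎)
    where
    h : ℕ → ℚ
    h k = binom n k * (f k * g (suc n ∸ k))
    A : ℚ
    A = ∑ (suc n) (λ k → binom n k * (f (suc k) * g (n ∸ k)))

  absorption : ∀ n k → ℕ→ℚ (suc k) * binom (suc n) (suc k) ≡ ℕ→ℚ (suc n) * binom n k
  absorption zero zero = refl
  absorption zero (suc k) = begin
    ℕ→ℚ (suc (suc k)) * binom 1 (suc (suc k)) ≡⟨ cong (ℕ→ℚ (suc (suc k)) *_) (binom-> {1} {suc (suc k)} (s≤s (s≤s z≤n))) ⟩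
    ℕ→ℚ (suc (suc k)) * 0ℚ ≡⟨ *-zeroʳ (ℕ→ℚ (suc (suc k))) ⟩
    0ℚ ≡⟨ cong (ℕ→ℚ 1 *_) (binom-> {0} {suc k} (s≤s z≤n)) ⟨
    ℕ→ℚ 1 * binom 0 (suc k) ∎
  absorption (suc n) zero = begin
    1ℚ * binom (suc (suc n)) 1 ≡⟨ *-identityˡ (binom (suc (suc n)) 1) ⟩
    binom (suc (suc n)) 1 ≡⟨ binom-pascal (suc n) 0 ⟩
    binom (suc n) 0 + binom (suc n) 1 ≡⟨ cong₂ _+_ (binom-n-0 (suc n)) (trans (sym (*-identityˡ (binom (suc n) 1))) (trans (absorption n 0) (cong (ℕ→ℚ (suc n) *_) (binom-n-0 n)))) ⟩
    1ℚ + ℕ→ℚ (suc n) * 1ℚ ≡⟨ solve 1 (λ a → con 1ℚ :+ a :* con 1ℚ := (con 1ℚ :+ a) :* con 1ℚ) refl (ℕ→ℚ (suc n)) ⟩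
    (1ℚ + ℕ→ℚ (suc n)) * 1ℚ ≡⟨ cong₂ _*_ (sym (ℕ→ℚ-suc (suc n))) (sym (binom-n-0 (suc n))) ⟩
    ℕ→ℚ (suc (suc n)) * binom (suc n) 0 ∎
  absorption (suc n) (suc k) = begin
    K₂ * binom (suc (suc n)) (suc (suc k)) ≡⟨ cong (K₂ *_) (binom-pascal (suc n) (suc k)) ⟩
    K₂ * (b + binom (suc n) (suc (suc k))) ≡⟨ *-distribˡ-+ K₂ b _ ⟩
    K₂ * b + K₂ * binom (suc n) (suc (suc k)) ≡⟨ cong₂ _+_ (cong (_* b) (ℕ→ℚ-suc (suc k))) (absorption n (suc k)) ⟩
    (1ℚ + ℕ→ℚ (suc k)) * b + N * binom n (suc k)
      ≡⟨ solve 4 (λ a b c d → (con 1ℚ :+ a) :* b :+ c :* d := b :+ (a :* b :+ c :* d)) refl (ℕ→ℚ (suc k)) b N (binom n (suc k)) ⟩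
    b + (ℕ→ℚ (suc k) * b + N * binom n (suc k)) ≡⟨ cong (λ z → b + (z + N * binom n (suc k))) (absorption n k) ⟩
    b + (N * binom n k + N * binom n (suc k)) ≡⟨ cong (b +_) (trans (sym (*-distribˡ-+ N _ _)) (cong (N *_) (sym (binom-pascal n k)))) ⟩
    b + N * b ≡⟨ solve 2 (λ a b → b :+ a :* b := (con 1ℚ :+ a) :* b) refl N b ⟩
    (1ℚ + N) * b ≡⟨ cong (_* b) (sym (ℕ→ℚ-suc (suc n))) ⟩
    ℕ→ℚ (suc (suc n)) * b ∎
    where
    K₂ b N : ℚ
    K₂ = ℕ→ℚ (suc (suc k))
    b = binom (suc n) (suc k)
    N = ℕ→ℚ (suc n)

  -- Absorption, solved for the binomial coefficient: with `suc n` equal to p it exhibits the factor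
  -- p of C(p,k) exactly, so that division by p is possible in `ℚ`.
  binom-suc-suc : ∀ n k → binom (suc n) (suc k) ≡ ℕ→ℚ (suc n) * (inv (suc k) * binom n k)
  binom-suc-suc n k = begin
    b ≡⟨ sym (*-identityˡ b) ⟩
    1ℚ * b ≡⟨ cong (_* b) (sym (n*inv[n]≡1 k)) ⟩
    K * i * b ≡⟨ solve 3 (λ K i b → K :* i :* b := i :* (K :* b)) refl K i b ⟩
    i * (K * b) ≡⟨ cong (i *_) (absorption n k) ⟩
    i * (ℕ→ℚ (suc n) * binom n k) ≡⟨ solve 3 (λ i n b → i :* (n :* b) := n :* (i :* b)) refl i (ℕ→ℚ (suc n)) (binom n k) ⟩
    ℕ→ℚ (suc n) * (i * binom n k) ∎
    where
    K i b : ℚ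
    K = ℕ→ℚ (suc k)
    i = inv (suc k)
    b = binom (suc n) (suc k)

  ^ℚ-distrib-* : ∀ n x y → (x * y) ^ℚ n ≡ x ^ℚ n * y ^ℚ n
  ^ℚ-distrib-* zero    x y = refl
  ^ℚ-distrib-* (suc n) x y = trans (cong ((x * y) *_) (^ℚ-distrib-* n x y))
    (solve 4 (λ a b c d → a :* b :* (c :* d) := (a :* c) :* (b :* d)) refl x y (x ^ℚ n) (y ^ℚ n))

  1^ℚ : ∀ n → 1ℚ ^ℚ n ≡ 1ℚ
  1^ℚ zero    = refl
  1^ℚ (suc n) = trans (*-identityˡ (1ℚ ^ℚ n)) (1^ℚ n)

  ^ℚ-+ : ∀ m n x → x ^ℚ (m ℕ.+ n) ≡ x ^ℚ m * x ^ℚ n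
  ^ℚ-+ zero    n x = sym (*-identityˡ (x ^ℚ n))
  ^ℚ-+ (suc m) n x = trans (cong (x *_) (^ℚ-+ m n x)) (sym (*-assoc x (x ^ℚ m) (x ^ℚ n)))

  ℕ→ℚ-^ : ∀ m n → ℕ→ℚ (m ℕ.^ n) ≡ ℕ→ℚ m ^ℚ n
  ℕ→ℚ-^ m zero    = refl
  ℕ→ℚ-^ m (suc n) = trans (ℕ→ℚ-* m (m ℕ.^ n)) (cong (ℕ→ℚ m *_) (ℕ→ℚ-^ m n))


  -- Bernoulli numbers and polynomials

  lookup-∷ʳ-fromℕ : ∀ {A : Set} {n} (v : Vec A n) x → lookup (v ∷ʳ x) (fromℕ n) ≡ x
  lookup-∷ʳ-fromℕ []      x = refl
  lookup-∷ʳ-fromℕ (_ ∷ v) x = lookup-∷ʳ-fromℕ v x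

  lookup-∷ʳ : ∀ {A : Set} {n} (f : ℕ → A) (v : Vec A n) {x} → (∀ i → lookup v i ≡ f (toℕ i)) → x ≡ f n →
    ∀ i → lookup (v ∷ʳ x) i ≡ f (toℕ i)
  lookup-∷ʳ f []      v≡f x≡f Fin.zero    = x≡f
  lookup-∷ʳ f (_ ∷ v) v≡f x≡f Fin.zero    = v≡f Fin.zero
  lookup-∷ʳ f (_ ∷ v) v≡f x≡f (Fin.suc i) = lookup-∷ʳ (f ∘ suc) v (v≡f ∘ Fin.suc) x≡f i

  lookup-bernVec : ∀ n (i : Fin n) → lookup (bernVec n) i ≡ bernoulli (toℕ i)
  lookup-bernVec (suc zero) Fin.zero = refl
  lookup-bernVec (suc (suc n)) = lookup-∷ʳ bernoulli (bernVec (suc n)) (lookup-bernVec (suc n))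
    (sym (lookup-∷ʳ-fromℕ (bernVec (suc n)) _))

  ΣFin-cong : ∀ n {f g : Fin n → ℚ} → (∀ i → f i ≡ g i) → ΣFin n f ≡ ΣFin n g
  ΣFin-cong zero    e = refl
  ΣFin-cong (suc n) e = cong₂ _+_ (e Fin.zero) (ΣFin-cong n (e ∘ Fin.suc))

  bernoulli-suc : ∀ n → bernoulli (suc n) ≡ - (inv (suc (suc n)) * ∑ (suc n) (λ k → binom (suc (suc n)) k * bernoulli k))
  bernoulli-suc n = trans (lookup-∷ʳ-fromℕ (bernVec (suc n)) _)
    (cong (λ z → - (inv (suc (suc n)) * z))
      (trans (ΣFin-cong (suc n) (λ i → cong (binom (suc (suc n)) (toℕ i) *_) (lookup-bernVec (suc n) i)))
             (ΣFin≡∑ (suc n) (λ k → binom (suc (suc n)) k * bernoulli k))))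

  binom-suc-n : ∀ n → binom (suc n) n ≡ ℕ→ℚ (suc n)
  binom-suc-n zero    = refl
  binom-suc-n (suc n) = begin
    binom (suc (suc n)) (suc n) ≡⟨ binom-pascal (suc n) n ⟩
    binom (suc n) n + binom (suc n) (suc n) ≡⟨ cong₂ _+_ (binom-suc-n n) (binom-n-n (suc n)) ⟩
    ℕ→ℚ (suc n) + 1ℚ ≡⟨ +-comm (ℕ→ℚ (suc n)) 1ℚ ⟩
    1ℚ + ℕ→ℚ (suc n) ≡⟨ sym (ℕ→ℚ-suc (suc n)) ⟩
    ℕ→ℚ (suc (suc n)) ∎

  -- The coefficients of the series z, as `δ` has those of the series 1.
  δ₁ : ℕ → ℚ
  δ₁ zero    = 0ℚ
  δ₁ (suc n) = δ n

  -- With B(z) = z/(eᶻ - 1) this is B(z)eᶻ = B(z) + z. For n ≥ 2 the recursion for Bₙ₋₁ cancels all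
  -- terms of index below n; the inhomogeneous term lives at n = 1 only.
  conv-bernoulli-1 : ∀ n → conv bernoulli (1ℚ ^ℚ_) n ≡ bernoulli n + δ₁ n
  conv-bernoulli-1 zero       = refl
  conv-bernoulli-1 (suc zero) = refl
  conv-bernoulli-1 (suc (suc n)) = begin
    conv bernoulli (1ℚ ^ℚ_) (suc (suc n)) ≡⟨ conv≡∑ (suc (suc n)) bernoulli (1ℚ ^ℚ_) ⟩
    ∑ (suc (suc (suc n))) (λ k → binom (suc (suc n)) k * (bernoulli k * 1ℚ ^ℚ (suc (suc n) ∸ k)))
      ≡⟨ ∑-cong (suc (suc (suc n))) (λ k _ → cong (binom (suc (suc n)) k *_)
           (trans (cong (bernoulli k *_) (1^ℚ (suc (suc n) ∸ k))) (*-identityʳ (bernoulli k)))) ⟩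
    ∑ (suc n) h + h (suc n) + h (suc (suc n))
      ≡⟨ cong₂ (λ a b → ∑ (suc n) h + a * bernoulli (suc n) + b * bernoulli (suc (suc n))) (binom-suc-n (suc n)) (binom-n-n (suc (suc n))) ⟩
    ∑ (suc n) h + N * bernoulli (suc n) + 1ℚ * bernoulli (suc (suc n))
      ≡⟨ cong (λ z → ∑ (suc n) h + N * z + 1ℚ * bernoulli (suc (suc n))) (bernoulli-suc n) ⟩
    ∑ (suc n) h + N * - (inv (suc (suc n)) * ∑ (suc n) h) + 1ℚ * bernoulli (suc (suc n))
      ≡⟨ solve 4 (λ s n i b → s :+ n :* (:- (i :* s)) :+ con 1ℚ :* b := s :- (n :* i) :* s :+ b) refl (∑ (suc n) h) N (inv (suc (suc n))) (bernoulli (suc (suc n))) ⟩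
    ∑ (suc n) h - (N * inv (suc (suc n))) * ∑ (suc n) h + bernoulli (suc (suc n))
      ≡⟨ cong (λ z → ∑ (suc n) h - z * ∑ (suc n) h + bernoulli (suc (suc n))) (n*inv[n]≡1 (suc n)) ⟩
    ∑ (suc n) h - 1ℚ * ∑ (suc n) h + bernoulli (suc (suc n))
      ≡⟨ solve 2 (λ s b → s :- con 1ℚ :* s :+ b := b :+ con 0ℚ) refl (∑ (suc n) h) (bernoulli (suc (suc n))) ⟩
    bernoulli (suc (suc n)) + 0ℚ ∎
    where
    N : ℚ
    N = ℕ→ℚ (suc (suc n))
    h : ℕ → ℚ
    h k = binom (suc (suc n)) k * bernoulli k

  -- z times the exponential series of xz is its derivative in x.
  conv-δ₁-exp : ∀ n x → conv δ₁ (x ^ℚ_) (suc n) ≡ ℕ→ℚ (suc n) * x ^ℚ n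
  conv-δ₁-exp n x = trans (cong₂ _+_ (conv-identityˡ n (x ^ℚ_)) (conv-scaleʳ n x δ₁ (x ^ℚ_))) (lem n)
    where
    lem : ∀ n → x ^ℚ n + x * conv δ₁ (x ^ℚ_) n ≡ ℕ→ℚ (suc n) * x ^ℚ n
    lem zero    = solve 1 (λ x → con 1ℚ :+ x :* (con 0ℚ :* con 1ℚ) := con 1ℚ :* con 1ℚ) refl x
    lem (suc n) = begin
      x * x ^ℚ n + x * conv δ₁ (x ^ℚ_) (suc n) ≡⟨ cong (λ z → x * x ^ℚ n + x * z) (conv-δ₁-exp n x) ⟩
      x * x ^ℚ n + x * (ℕ→ℚ (suc n) * x ^ℚ n)
        ≡⟨ solve 3 (λ x n y → x :* y :+ x :* (n :* y) := (con 1ℚ :+ n) :* (x :* y)) refl x (ℕ→ℚ (suc n)) (x ^ℚ n) ⟩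
      (1ℚ + ℕ→ℚ (suc n)) * (x * x ^ℚ n) ≡⟨ cong (_* (x * x ^ℚ n)) (sym (ℕ→ℚ-suc (suc n))) ⟩
      ℕ→ℚ (suc (suc n)) * (x * x ^ℚ n) ∎

  -- conv bernoulli (x ^ℚ_) n is the Bernoulli polynomial Bₙ(x).
  bernoulli-shift : ∀ n x → conv bernoulli ((1ℚ + x) ^ℚ_) n ≡ conv bernoulli (x ^ℚ_) n + conv δ₁ (x ^ℚ_) n
  bernoulli-shift n x = begin
    conv bernoulli ((1ℚ + x) ^ℚ_) n ≡⟨ conv-cong n (λ _ → refl) (λ k → sym (conv-exp k 1ℚ x)) ⟩
    conv bernoulli (conv (1ℚ ^ℚ_) (x ^ℚ_)) n ≡⟨ sym (conv-assoc n bernoulli (1ℚ ^ℚ_) (x ^ℚ_)) ⟩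
    conv (conv bernoulli (1ℚ ^ℚ_)) (x ^ℚ_) n ≡⟨ conv-cong n {g = x ^ℚ_} conv-bernoulli-1 (λ _ → refl) ⟩
    conv (λ k → bernoulli k + δ₁ k) (x ^ℚ_) n ≡⟨ conv-distribʳ n bernoulli δ₁ (x ^ℚ_) ⟩
    conv bernoulli (x ^ℚ_) n + conv δ₁ (x ^ℚ_) n ∎

  0^ℚ≡δ : ∀ n → 0ℚ ^ℚ n ≡ δ n
  0^ℚ≡δ zero    = refl
  0^ℚ≡δ (suc n) = *-zeroˡ (0ℚ ^ℚ n)

  -- Two unit shifts lead from -2 through -1 to 0, where the Bernoulli polynomial is the Bernoulli
  -- number. The shifted arguments `1ℚ + (- 1ℚ - 1ℚ)` and `1ℚ + - 1ℚ` agree with `- 1ℚ` and `0ℚ` by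
  -- computation.
  bernoulli-at-2 : ∀ n → conv bernoulli ((- 1ℚ - 1ℚ) ^ℚ_) (suc n) ≡
    bernoulli (suc n) - (ℕ→ℚ (suc n) * (- 1ℚ) ^ℚ n + ℕ→ℚ (suc n) * (- 1ℚ - 1ℚ) ^ℚ n)
  bernoulli-at-2 n = begin
    X₂ ≡⟨ solve 3 (λ a b c → a := a :+ b :+ c :- (c :+ b)) refl X₂ d₂ d₁ ⟩
    X₂ + d₂ + d₁ - (d₁ + d₂) ≡⟨ cong (λ z → z + d₁ - (d₁ + d₂)) (sym (bernoulli-shift (suc n) (- 1ℚ - 1ℚ))) ⟩
    X₁ + d₁ - (d₁ + d₂) ≡⟨ cong (_- (d₁ + d₂)) (sym (bernoulli-shift (suc n) (- 1ℚ))) ⟩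
    X₀ - (d₁ + d₂) ≡⟨ cong₂ (λ a b → a - b)
        (trans (conv-cong (suc n) {bernoulli} (λ _ → refl) 0^ℚ≡δ) (conv-identityʳ (suc n) bernoulli))
        (cong₂ _+_ (conv-δ₁-exp n (- 1ℚ)) (conv-δ₁-exp n (- 1ℚ - 1ℚ))) ⟩
    bernoulli (suc n) - (ℕ→ℚ (suc n) * (- 1ℚ) ^ℚ n + ℕ→ℚ (suc n) * (- 1ℚ - 1ℚ) ^ℚ n) ∎
    where
    X₀ X₁ X₂ d₁ d₂ : ℚ
    X₀ = conv bernoulli (0ℚ ^ℚ_) (suc n)
    X₁ = conv bernoulli ((- 1ℚ) ^ℚ_) (suc n)
    X₂ = conv bernoulli ((- 1ℚ - 1ℚ) ^ℚ_) (suc n)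
    d₁ = conv δ₁ ((- 1ℚ) ^ℚ_) (suc n)
    d₂ = conv δ₁ ((- 1ℚ - 1ℚ) ^ℚ_) (suc n)

  -- Finite differences of powers

  conv-index : ∀ n f h → conv f (λ k → ℕ→ℚ k * h k) (suc n) ≡ ℕ→ℚ (suc n) * conv f (h ∘ suc) n
  conv-index n f h = trans (cong (conv (f ∘ suc) ih n +_) (trans
      (conv-cong n {f} {g′ = λ k → h (suc k) + ℕ→ℚ k * h (suc k)} (λ _ → refl) (λ k → trans (cong (_* h (suc k)) (ℕ→ℚ-suc k))
        (solve 2 (λ a b → (con 1ℚ :+ a) :* b := b :+ a :* b) refl (ℕ→ℚ k) (h (suc k)))))
      (conv-distribˡ n f (h ∘ suc) (λ k → ℕ→ℚ k * h (suc k))))) (lem n)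
    where
    ih : ℕ → ℚ
    ih k = ℕ→ℚ k * h k
    lem : ∀ n → conv (f ∘ suc) ih n + (conv f (h ∘ suc) n + conv f (λ k → ℕ→ℚ k * h (suc k)) n) ≡ ℕ→ℚ (suc n) * conv f (h ∘ suc) n
    lem zero = solve 4 (λ a b c d → a :* (con 0ℚ :* b) :+ (c :* d :+ c :* (con 0ℚ :* d)) := con 1ℚ :* (c :* d)) refl (f 1) (h 0) (f 0) (h 1)
    lem (suc n) = begin
      conv (f ∘ suc) ih (suc n) + (D + conv f (λ k → ℕ→ℚ k * h (suc k)) (suc n))
        ≡⟨ cong₂ (λ a b → a + (D + b)) (conv-index n (f ∘ suc) h) (conv-index n f (h ∘ suc)) ⟩
      N * conv (f ∘ suc) (h ∘ suc) n + (D + N * conv f (h ∘ suc ∘ suc) n)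
        ≡⟨ solve 3 (λ n a b → n :* a :+ ((a :+ b) :+ n :* b) := (con 1ℚ :+ n) :* (a :+ b)) refl N (conv (f ∘ suc) (h ∘ suc) n) (conv f (h ∘ suc ∘ suc) n) ⟩
      (1ℚ + N) * D ≡⟨ cong (_* D) (sym (ℕ→ℚ-suc (suc n))) ⟩
      ℕ→ℚ (suc (suc n)) * D ∎
      where
      N D : ℚ
      N = ℕ→ℚ (suc n)
      D = conv f (h ∘ suc) (suc n)

  -- Σₖ C(n,k) (-1)ᵏ (c + n - k)ᵐ, the n-th forward difference of x ↦ xᵐ at x = c.
  difference : ℕ → ℕ → ℚ → ℚ
  difference n m c = conv ((- 1ℚ) ^ℚ_) (λ k → (c + ℕ→ℚ k) ^ℚ m) n

  -- One factor c + k is split off the power. Weighting coefficients by k amounts to z times a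
  -- derivative, so `conv-index` lowers the order and moves the base point to 1 + c.
  difference-suc : ∀ n m c → difference (suc n) (suc m) c ≡
    c * difference (suc n) m c + ℕ→ℚ (suc n) * difference n m (1ℚ + c)
  difference-suc n m c = begin
    difference (suc n) (suc m) c
      ≡⟨ conv-cong (suc n) {(- 1ℚ) ^ℚ_} (λ _ → refl) (λ k → *-distribʳ-+ (x k) c (ℕ→ℚ k)) ⟩
    conv ((- 1ℚ) ^ℚ_) (λ k → c * x k + ℕ→ℚ k * x k) (suc n)
      ≡⟨ conv-distribˡ (suc n) ((- 1ℚ) ^ℚ_) (λ k → c * x k) (λ k → ℕ→ℚ k * x k) ⟩
    conv ((- 1ℚ) ^ℚ_) (λ k → c * x k) (suc n) + conv ((- 1ℚ) ^ℚ_) (λ k → ℕ→ℚ k * x k) (suc n)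
      ≡⟨ cong₂ _+_ (conv-scaleʳ (suc n) c ((- 1ℚ) ^ℚ_) x) (conv-index n ((- 1ℚ) ^ℚ_) x) ⟩
    c * difference (suc n) m c + ℕ→ℚ (suc n) * conv ((- 1ℚ) ^ℚ_) (x ∘ suc) n
      ≡⟨ cong (λ z → c * difference (suc n) m c + ℕ→ℚ (suc n) * z)
          (conv-cong n {(- 1ℚ) ^ℚ_} (λ _ → refl) (λ k → cong (_^ℚ m) (trans (cong (c +_) (ℕ→ℚ-suc k))
             (solve 2 (λ c k → c :+ (con 1ℚ :+ k) := con 1ℚ :+ c :+ k) refl c (ℕ→ℚ k))))) ⟩
    c * difference (suc n) m c + ℕ→ℚ (suc n) * difference n m (1ℚ + c) ∎
    where
    x : ℕ → ℚ
    x k = (c + ℕ→ℚ k) ^ℚ m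

  -- Differences of constants are values of (-1 + 1)ⁿ, and `difference-suc` lowers the degree while
  -- keeping it below the order.
  difference-< : ∀ {m n} c → m < n → difference n m c ≡ 0ℚ
  difference-< {zero} {suc n} c _ = begin
    conv ((- 1ℚ) ^ℚ_) (λ _ → 1ℚ) (suc n) ≡⟨ conv-cong (suc n) {(- 1ℚ) ^ℚ_} (λ _ → refl) (λ k → sym (1^ℚ k)) ⟩
    conv ((- 1ℚ) ^ℚ_) (1ℚ ^ℚ_) (suc n) ≡⟨ conv-exp (suc n) (- 1ℚ) 1ℚ ⟩
    0ℚ * 0ℚ ^ℚ n ≡⟨ *-zeroˡ (0ℚ ^ℚ n) ⟩
    0ℚ ∎
  difference-< {suc m} {suc n} c (s≤s m<n) = begin
    difference (suc n) (suc m) c ≡⟨ difference-suc n m c ⟩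
    c * difference (suc n) m c + ℕ→ℚ (suc n) * difference n m (1ℚ + c)
      ≡⟨ cong₂ (λ a b → c * a + ℕ→ℚ (suc n) * b) (difference-< c (ℕₚ.m<n⇒m<1+n m<n)) (difference-< (1ℚ + c) m<n) ⟩
    c * 0ℚ + ℕ→ℚ (suc n) * 0ℚ ≡⟨ solve 2 (λ a b → a :* con 0ℚ :+ b :* con 0ℚ := con 0ℚ) refl c (ℕ→ℚ (suc n)) ⟩
    0ℚ ∎

  -- The term with unchanged order vanishes by `difference-<`, so the factorial builds up from the
  -- other one. This expression for n! is the source of Wilson's theorem below.
  difference-≡ : ∀ n c → difference n n c ≡ ℕ→ℚ (n !)
  difference-≡ zero    c = refl
  difference-≡ (suc n) c = begin
    difference (suc n) (suc n) c ≡⟨ difference-suc n n c ⟩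
    c * difference (suc n) n c + ℕ→ℚ (suc n) * difference n n (1ℚ + c)
      ≡⟨ cong₂ (λ a b → c * a + ℕ→ℚ (suc n) * b) (difference-< {n} c ℕₚ.≤-refl) (difference-≡ n (1ℚ + c)) ⟩
    c * 0ℚ + ℕ→ℚ (suc n) * ℕ→ℚ (n !) ≡⟨ solve 2 (λ c x → c :* con 0ℚ :+ x := x) refl c (ℕ→ℚ (suc n) * ℕ→ℚ (n !)) ⟩
    ℕ→ℚ (suc n) * ℕ→ℚ (n !) ≡⟨ sym (ℕ→ℚ-* (suc n) (n !)) ⟩
    ℕ→ℚ (suc n !) ∎

  -- Alternating power sums from the functional equation

  2ℚ : ℚ
  2ℚ = ℕ→ℚ 2

  ∑-const-1 : ∀ n → ∑ n (λ _ → 1ℚ) ≡ ℕ→ℚ n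
  ∑-const-1 zero    = refl
  ∑-const-1 (suc n) = trans (cong (_+ 1ℚ) (∑-const-1 n)) (trans (+-comm (ℕ→ℚ n) 1ℚ) (sym (ℕ→ℚ-suc n)))

  neg1-square : ∀ n → (- 1ℚ) ^ℚ n * (- 1ℚ) ^ℚ n ≡ 1ℚ
  neg1-square n = trans (sym (^ℚ-distrib-* n (- 1ℚ) (- 1ℚ))) (1^ℚ n)

  ∑-binom : ∀ n → ∑ (suc n) (binom n) ≡ 2ℚ ^ℚ n
  ∑-binom n = begin
    ∑ (suc n) (binom n) ≡⟨ ∑-cong (suc n) (λ k _ → trans (sym (*-identityʳ (binom n k)))
         (cong (binom n k *_) (sym (cong₂ _*_ (1^ℚ k) (1^ℚ (n ∸ k)))))) ⟩
    ∑ (suc n) (λ k → binom n k * (1ℚ ^ℚ k * 1ℚ ^ℚ (n ∸ k))) ≡⟨ sym (conv≡∑ n (1ℚ ^ℚ_) (1ℚ ^ℚ_)) ⟩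
    conv (1ℚ ^ℚ_) (1ℚ ^ℚ_) n ≡⟨ conv-exp n 1ℚ 1ℚ ⟩
    2ℚ ^ℚ n ∎

  -- Iterating the functional equation E(x)(e²ˣ + 1) = 2e²ˣ of generating functions.
  alternating-shift : ∀ (E : ℕ → ℚ) → (∀ n → conv E (2ℚ ^ℚ_) n + E n ≡ 2ℚ * 2ℚ ^ℚ n) → ∀ k n →
    (- 1ℚ) ^ℚ k * conv E ((2ℚ * ℕ→ℚ k) ^ℚ_) n ≡
    E n - 2ℚ * ∑ k (λ i → (- 1ℚ) ^ℚ i * (2ℚ * ℕ→ℚ (suc i)) ^ℚ n)
  alternating-shift E fun zero n = begin
    1ℚ * conv E (0ℚ ^ℚ_) n ≡⟨ *-identityˡ (conv E (0ℚ ^ℚ_) n) ⟩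
    conv E (0ℚ ^ℚ_) n ≡⟨ conv-cong n {E} (λ _ → refl) 0^ℚ≡δ ⟩
    conv E δ n ≡⟨ conv-identityʳ n E ⟩
    E n ≡⟨ solve 1 (λ e → e := e :- con 2ℚ :* con 0ℚ) refl (E n) ⟩
    E n - 2ℚ * 0ℚ ∎
  alternating-shift E fun (suc k) n = begin
    (- 1ℚ * σ) * conv E (y ^ℚ_) n
      ≡⟨ cong ((- 1ℚ * σ) *_) shift ⟩
    (- 1ℚ * σ) * (2ℚ * y ^ℚ n - conv E (x ^ℚ_) n)
      ≡⟨ solve 3 (λ s y c → (con (- 1ℚ) :* s) :* (con 2ℚ :* y :- c) := s :* c :- con 2ℚ :* (s :* y)) refl σ (y ^ℚ n) (conv E (x ^ℚ_) n) ⟩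
    σ * conv E (x ^ℚ_) n - 2ℚ * (σ * y ^ℚ n)
      ≡⟨ cong (_- 2ℚ * (σ * y ^ℚ n)) (alternating-shift E fun k n) ⟩
    E n - 2ℚ * T - 2ℚ * (σ * y ^ℚ n)
      ≡⟨ solve 3 (λ e t u → e :- con 2ℚ :* t :- con 2ℚ :* u := e :- con 2ℚ :* (t :+ u)) refl (E n) T (σ * y ^ℚ n) ⟩
    E n - 2ℚ * (T + σ * y ^ℚ n) ∎
    where
    x y σ T : ℚ
    x = 2ℚ * ℕ→ℚ k
    y = 2ℚ * ℕ→ℚ (suc k)
    σ = (- 1ℚ) ^ℚ k
    T = ∑ k (λ i → (- 1ℚ) ^ℚ i * (2ℚ * ℕ→ℚ (suc i)) ^ℚ n)
    2+x≡y : 2ℚ + x ≡ y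
    2+x≡y = trans (solve 1 (λ k → con 2ℚ :+ con 2ℚ :* k := con 2ℚ :* (con 1ℚ :+ k)) refl (ℕ→ℚ k)) (cong (2ℚ *_) (sym (ℕ→ℚ-suc k)))
    double : conv E (y ^ℚ_) n + conv E (x ^ℚ_) n ≡ 2ℚ * y ^ℚ n
    double = begin
      conv E (y ^ℚ_) n + conv E (x ^ℚ_) n
        ≡⟨ cong (_+ conv E (x ^ℚ_) n) (conv-cong n {E} (λ _ → refl) (λ j → trans (cong (_^ℚ j) (sym 2+x≡y)) (sym (conv-exp j 2ℚ x)))) ⟩
      conv E (conv (2ℚ ^ℚ_) (x ^ℚ_)) n + conv E (x ^ℚ_) n
        ≡⟨ cong (_+ conv E (x ^ℚ_) n) (sym (conv-assoc n E (2ℚ ^ℚ_) (x ^ℚ_))) ⟩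
      conv (conv E (2ℚ ^ℚ_)) (x ^ℚ_) n + conv E (x ^ℚ_) n
        ≡⟨ sym (conv-distribʳ n (conv E (2ℚ ^ℚ_)) E (x ^ℚ_)) ⟩
      conv (λ j → conv E (2ℚ ^ℚ_) j + E j) (x ^ℚ_) n
        ≡⟨ conv-cong n {g = x ^ℚ_} fun (λ _ → refl) ⟩
      conv (λ j → 2ℚ * 2ℚ ^ℚ j) (x ^ℚ_) n
        ≡⟨ conv-scaleˡ n 2ℚ (2ℚ ^ℚ_) (x ^ℚ_) ⟩
      2ℚ * conv (2ℚ ^ℚ_) (x ^ℚ_) n
        ≡⟨ cong (2ℚ *_) (trans (conv-exp n 2ℚ x) (cong (_^ℚ n) 2+x≡y)) ⟩
      2ℚ * y ^ℚ n ∎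
    shift : conv E (y ^ℚ_) n ≡ 2ℚ * y ^ℚ n - conv E (x ^ℚ_) n
    shift = trans (solve 2 (λ a b → a := a :+ b :- b) refl (conv E (y ^ℚ_) n) (conv E (x ^ℚ_) n)) (cong (_- conv E (x ^ℚ_) n) double)

  -- Weighted sums over words

  ΣFin-+ : ∀ n (f g : Fin n → ℚ) → ΣFin n (λ i → f i + g i) ≡ ΣFin n f + ΣFin n g
  ΣFin-+ zero    f g = refl
  ΣFin-+ (suc n) f g = trans (cong (f Fin.zero + g Fin.zero +_) (ΣFin-+ n (f ∘ Fin.suc) (g ∘ Fin.suc)))
    (solve 4 (λ a b c d → a :+ b :+ (c :+ d) := a :+ c :+ (b :+ d)) refl (f Fin.zero) (g Fin.zero) (ΣFin n (f ∘ Fin.suc)) (ΣFin n (g ∘ Fin.suc)))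

  ΣFin-*ˡ : ∀ n c (f : Fin n → ℚ) → ΣFin n (λ i → c * f i) ≡ c * ΣFin n f
  ΣFin-*ˡ zero    c f = sym (*-zeroʳ c)
  ΣFin-*ˡ (suc n) c f = trans (cong (c * f Fin.zero +_) (ΣFin-*ˡ n c (f ∘ Fin.suc))) (sym (*-distribˡ-+ c (f Fin.zero) _))

  ΣFin-0 : ∀ n → ΣFin n (λ _ → 0ℚ) ≡ 0ℚ
  ΣFin-0 zero    = refl
  ΣFin-0 (suc n) = trans (+-identityˡ _) (ΣFin-0 n)

  mutual
    -- Names the local sum of countVec: the underscore is solved by countVec-suc-suc,
    -- after abstraction makes its arguments distinct variables.
    sumF : (m n : ℕ) (P : Vec (Fin m) (suc n) → Bool) (k : ℕ) → (Fin k → ℕ) → ℕ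
    sumF = _

    countVec-suc-suc : ∀ m n (P : Vec (Fin (suc m)) (suc n) → Bool) → countVec (suc m) (suc n) P ≡
      countVec (suc m) n (λ w → P (Fin.zero ∷ w)) ℕ.+ sumF (suc m) n P m (λ i → countVec (suc m) n (λ w → P (Fin.suc i ∷ w)))
    countVec-suc-suc m n P
      with countVec (suc m) n (λ w → P (Fin.zero ∷ w)) | (λ (i : Fin m) → countVec (suc m) n (λ w → P (Fin.suc i ∷ w)))
    ... | _ | _ with suc m
    ... | _ = refl

  sumF≡ΣFin : ∀ m n P k f → ℕ→ℚ (sumF m n P k f) ≡ ΣFin k (ℕ→ℚ ∘ f)
  sumF≡ΣFin m n P zero    f = refl
  sumF≡ΣFin m n P (suc k) f = trans (ℕ→ℚ-+ (f Fin.zero) _) (cong (ℕ→ℚ (f Fin.zero) +_) (sumF≡ΣFin m n P k (f ∘ Fin.suc)))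

  𝟙 : Bool → ℚ
  𝟙 b = if b then 1ℚ else 0ℚ

  𝟙-∧ : ∀ a b → 𝟙 (a ∧ b) ≡ 𝟙 a * 𝟙 b
  𝟙-∧ true  b = sym (*-identityˡ (𝟙 b))
  𝟙-∧ false b = sym (*-zeroˡ (𝟙 b))

  -- Mirrors the recursion of `countVec` with rational weights, so that plain and signed counts
  -- become sums to which linearity applies.
  sumVec : (m n : ℕ) → (Vec (Fin m) n → ℚ) → ℚ
  sumVec m zero    W = W []
  sumVec m (suc n) W = ΣFin m (λ i → sumVec m n (λ w → W (i ∷ w)))

  sumVec-cong : ∀ m n {V W} → (∀ v → V v ≡ W v) → sumVec m n V ≡ sumVec m n W
  sumVec-cong m zero    e = e []
  sumVec-cong m (suc n) e = ΣFin-cong m (λ i → sumVec-cong m n (λ w → e (i ∷ w)))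

  sumVec-+ : ∀ m n V W → sumVec m n (λ v → V v + W v) ≡ sumVec m n V + sumVec m n W
  sumVec-+ m zero    V W = refl
  sumVec-+ m (suc n) V W = trans (ΣFin-cong m (λ i → sumVec-+ m n (λ w → V (i ∷ w)) (λ w → W (i ∷ w))))
    (ΣFin-+ m (λ i → sumVec m n (λ w → V (i ∷ w))) (λ i → sumVec m n (λ w → W (i ∷ w))))

  sumVec-*ˡ : ∀ m n c W → sumVec m n (λ v → c * W v) ≡ c * sumVec m n W
  sumVec-*ˡ m zero    c W = refl
  sumVec-*ˡ m (suc n) c W = trans (ΣFin-cong m (λ i → sumVec-*ˡ m n c (λ w → W (i ∷ w))))
    (ΣFin-*ˡ m c (λ i → sumVec m n (λ w → W (i ∷ w))))

  countVec≡sumVec : ∀ m n P → ℕ→ℚ (countVec m n P) ≡ sumVec m n (𝟙 ∘ P)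
  countVec≡sumVec m zero P with P []
  ... | true  = refl
  ... | false = refl
  countVec≡sumVec zero    (suc n) P = refl
  countVec≡sumVec (suc m) (suc n) P = trans (sumF≡ΣFin (suc m) n P (suc m) (λ i → countVec (suc m) n (λ w → P (i ∷ w))))
    (ΣFin-cong (suc m) (λ i → countVec≡sumVec (suc m) n (λ w → P (i ∷ w))))

  ΣFin-single : ∀ n (j : Fin n) (f : Fin n → ℚ) → ΣFin n (λ i → 𝟙 ⌊ i ≟ᶠ j ⌋ * f i) ≡ f j
  ΣFin-single (suc n) Fin.zero f = begin
    1ℚ * f Fin.zero + ΣFin n (λ i → 0ℚ * f (Fin.suc i))
      ≡⟨ cong₂ _+_ (*-identityˡ (f Fin.zero)) (trans (ΣFin-cong n (λ i → *-zeroˡ (f (Fin.suc i)))) (ΣFin-0 n)) ⟩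
    f Fin.zero + 0ℚ ≡⟨ +-identityʳ (f Fin.zero) ⟩
    f Fin.zero ∎
  ΣFin-single (suc n) (Fin.suc j) f = begin
    0ℚ * f Fin.zero + ΣFin n (λ i → 𝟙 ⌊ Fin.suc i ≟ᶠ Fin.suc j ⌋ * f (Fin.suc i))
      ≡⟨ cong₂ _+_ (*-zeroˡ (f Fin.zero)) (trans (ΣFin-cong n (λ i → cong (λ b → 𝟙 b * f (Fin.suc i)) (lem i))) (ΣFin-single n j (f ∘ Fin.suc))) ⟩
    0ℚ + f (Fin.suc j) ≡⟨ +-identityˡ (f (Fin.suc j)) ⟩
    f (Fin.suc j) ∎
    where
    lem : ∀ i → ⌊ Fin.suc i ≟ᶠ Fin.suc j ⌋ ≡ ⌊ i ≟ᶠ j ⌋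
    lem i with i ≟ᶠ j
    ... | yes _ = refl
    ... | no  _ = refl

  -- With the identity as `u`, this accounts for the one permutation that `M` leaves out.
  sumVec-single : ∀ m n (u : Vec (Fin m) n) W → sumVec m n (λ v → 𝟙 ⌊ ≡-dec _≟ᶠ_ v u ⌋ * W v) ≡ W u
  sumVec-single m zero    []      W = *-identityˡ (W [])
  sumVec-single m (suc n) (j ∷ u) W = begin
    ΣFin m (λ i → sumVec m n (λ w → 𝟙 ⌊ ≡-dec _≟ᶠ_ (i ∷ w) (j ∷ u) ⌋ * W (i ∷ w)))
      ≡⟨ ΣFin-cong m (λ i → trans (sumVec-cong m n (λ w → lem i w)) (sumVec-*ˡ m n (𝟙 ⌊ i ≟ᶠ j ⌋) (λ w → 𝟙 ⌊ ≡-dec _≟ᶠ_ w u ⌋ * W (i ∷ w)))) ⟩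
    ΣFin m (λ i → 𝟙 ⌊ i ≟ᶠ j ⌋ * sumVec m n (λ w → 𝟙 ⌊ ≡-dec _≟ᶠ_ w u ⌋ * W (i ∷ w)))
      ≡⟨ ΣFin-single m j (λ i → sumVec m n (λ w → 𝟙 ⌊ ≡-dec _≟ᶠ_ w u ⌋ * W (i ∷ w))) ⟩
    sumVec m n (λ w → 𝟙 ⌊ ≡-dec _≟ᶠ_ w u ⌋ * W (j ∷ w)) ≡⟨ sumVec-single m n u (λ w → W (j ∷ w)) ⟩
    W (j ∷ u) ∎
    where
    lem : ∀ i w → 𝟙 ⌊ ≡-dec _≟ᶠ_ (i ∷ w) (j ∷ u) ⌋ * W (i ∷ w) ≡ 𝟙 ⌊ i ≟ᶠ j ⌋ * (𝟙 ⌊ ≡-dec _≟ᶠ_ w u ⌋ * W (i ∷ w))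
    lem i w with i ≟ᶠ j | ≡-dec _≟ᶠ_ w u
    ... | yes _ | yes _ = sym (*-identityˡ (1ℚ * W (i ∷ w)))
    ... | yes _ | no  _ = sym (*-identityˡ (0ℚ * W (i ∷ w)))
    ... | no  _ | yes _ = trans (*-zeroˡ (W (i ∷ w))) (sym (*-zeroˡ (1ℚ * W (i ∷ w))))
    ... | no  _ | no  _ = trans (*-zeroˡ (W (i ∷ w))) (sym (*-zeroˡ (0ℚ * W (i ∷ w))))

  -- Permutations weighted by ascents

  weight : ℚ → ∀ {m} → List (Fin m) → ℚ
  weight t l = 𝟙 (distinct l) * t ^ℚ ascents l

  allB-∧ : ∀ {A : Set} (f g : A → Bool) l → 𝟙 (allB (λ y → f y ∧ g y) l) ≡ 𝟙 (allB f l) * 𝟙 (allB g l)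
  allB-∧ f g []      = refl
  allB-∧ f g (x ∷ l) = begin
    𝟙 ((f x ∧ g x) ∧ allB (λ y → f y ∧ g y) l) ≡⟨ 𝟙-∧ (f x ∧ g x) _ ⟩
    𝟙 (f x ∧ g x) * 𝟙 (allB (λ y → f y ∧ g y) l) ≡⟨ cong₂ _*_ (𝟙-∧ (f x) (g x)) (allB-∧ f g l) ⟩
    𝟙 (f x) * 𝟙 (g x) * (𝟙 (allB f l) * 𝟙 (allB g l))
      ≡⟨ solve 4 (λ a b c d → a :* b :* (c :* d) := (a :* c) :* (b :* d)) refl (𝟙 (f x)) (𝟙 (g x)) (𝟙 (allB f l)) (𝟙 (allB g l)) ⟩
    𝟙 (f x) * 𝟙 (allB f l) * (𝟙 (g x) * 𝟙 (allB g l)) ≡⟨ sym (cong₂ _*_ (𝟙-∧ (f x) (allB f l)) (𝟙-∧ (g x) (allB g l))) ⟩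
    𝟙 (f x ∧ allB f l) * 𝟙 (g x ∧ allB g l) ∎

  count : ∀ {m} → (Fin m → Bool) → ℕ
  count {zero}  a = 0
  count {suc m} a = (if a Fin.zero then 1 else 0) ℕ.+ count (a ∘ Fin.suc)

  -- The rank of a letter among those that the mask `a` leaves available.
  below : ∀ {m} → (Fin m → Bool) → Fin m → ℕ
  below a Fin.zero    = 0
  below a (Fin.suc i) = (if a Fin.zero then 1 else 0) ℕ.+ below (a ∘ Fin.suc) i

  count-cong : ∀ {m} {a b : Fin m → Bool} → (∀ i → a i ≡ b i) → count a ≡ count b
  count-cong {zero}  e = refl
  count-cong {suc m} e = cong₂ (λ x y → (if x then 1 else 0) ℕ.+ y) (e Fin.zero) (count-cong (e ∘ Fin.suc))

  count-true : ∀ m → count {m} (λ _ → true) ≡ m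
  count-true zero    = refl
  count-true (suc m) = cong suc (count-true m)

  count-remove : ∀ {m} {a b : Fin m → Bool} i → a i ≡ true → b i ≡ false → (∀ j → j ≢ i → b j ≡ a j) → count a ≡ suc (count b)
  count-remove {suc m} {a} {b} Fin.zero at bf e rewrite at | bf =
    cong suc (count-cong (λ j → sym (e (Fin.suc j) (λ ()))))
  count-remove {suc m} {a} {b} (Fin.suc i) at bf e rewrite e Fin.zero (λ ()) =
    trans (cong ((if a Fin.zero then 1 else 0) ℕ.+_)
      (count-remove {a = a ∘ Fin.suc} {b ∘ Fin.suc} i at bf (λ j j≢i → e (Fin.suc j) (j≢i ∘ Finₚ.suc-injective))))
      (ℕₚ.+-suc (if a Fin.zero then 1 else 0) _)

  below-remove : ∀ {m} {a b : Fin m → Bool} i → (∀ j → j ≢ i → b j ≡ a j) → below b i ≡ below a i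
  below-remove Fin.zero    e = refl
  below-remove (Fin.suc i) e = cong₂ (λ x y → (if x then 1 else 0) ℕ.+ y) (e Fin.zero (λ ()))
    (below-remove i (λ j j≢i → e (Fin.suc j) (j≢i ∘ Finₚ.suc-injective)))

  -- Over the available letters in increasing order the ranks run through 0, 1, 2, ..., so the set
  -- matters only through its size. This relabelling is what lets `ascentSum` depend on two numbers
  -- alone.
  ΣFin-below : ∀ m (a : Fin m → Bool) φ → ΣFin m (λ i → 𝟙 (a i) * φ (below a i)) ≡ ∑ (count a) φ
  ΣFin-below zero    a φ = refl
  ΣFin-below (suc m) a φ with a Fin.zero
  ... | true  = trans (cong₂ _+_ (*-identityˡ (φ 0)) (ΣFin-below m (a ∘ Fin.suc) (φ ∘ suc))) (sym (∑-head (count (a ∘ Fin.suc)) φ))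
  ... | false = trans (cong₂ _+_ (*-zeroˡ (φ 0)) (ΣFin-below m (a ∘ Fin.suc) φ)) (+-identityˡ _)

  -- The same enumeration stopped at `x`: the available letters smaller than `x` have exactly the
  -- ranks below that of `x`.
  ΣFin-below-< : ∀ m (a : Fin m → Bool) φ x →
    ΣFin m (λ i → 𝟙 (toℕ i ℕ.<ᵇ toℕ x) * (𝟙 (a i) * φ (below a i))) ≡ ∑ (below a x) φ
  ΣFin-below-< (suc m) a φ Fin.zero = trans (cong₂ _+_ (*-zeroˡ (𝟙 (a Fin.zero) * φ 0))
    (trans (ΣFin-cong m (λ i → *-zeroˡ (𝟙 (a (Fin.suc i)) * φ (below a (Fin.suc i))))) (ΣFin-0 m))) refl
  ΣFin-below-< (suc m) a φ (Fin.suc x) with a Fin.zero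
  ... | true  = trans (cong₂ _+_ (trans (*-identityˡ (1ℚ * φ 0)) (*-identityˡ (φ 0))) (ΣFin-below-< m (a ∘ Fin.suc) (φ ∘ suc) x))
    (sym (∑-head (below (a ∘ Fin.suc) x) φ))
  ... | false = trans (cong₂ _+_ (trans (*-identityˡ (0ℚ * φ 0)) (*-zeroˡ (φ 0))) (ΣFin-below-< m (a ∘ Fin.suc) φ x)) (+-identityˡ _)

  -- ascentSum t n k is the sum of t^ascents over the words x ∷ w, where w arranges n letters
  -- exactly k of which are smaller than the fixed letter x.
  ascentSum : ℚ → ℕ → ℕ → ℚ
  ascentSum t zero    k = 1ℚ
  ascentSum t (suc n) k = t * ∑ (suc n) (ascentSum t n) + (1ℚ - t) * ∑ k (ascentSum t n)

  -- A fixed letter above all others is followed by a descent, of weight 1, so prepending it leaves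
  -- the total over all permutations unchanged. Hence `ascentSum t n n` is that total for every n,
  -- including 0.
  ascentSum-diagonal : ∀ t n → ascentSum t (suc n) (suc n) ≡ ∑ (suc n) (ascentSum t n)
  ascentSum-diagonal t n = solve 2 (λ t a → t :* a :+ (con 1ℚ :- t) :* a := a) refl t (∑ (suc n) (ascentSum t n))

  module _ (t : ℚ) {m : ℕ} where

    arrangements : (Fin m → Bool) → Fin m → ℕ → ℚ
    arrangements a x n = sumVec m n (λ w → 𝟙 (allB a (toList w)) * 𝟙 (distinct (toList w)) * t ^ℚ ascents (x List.∷ toList w))

    remove : (Fin m → Bool) → Fin m → Fin m → Bool
    remove a i j = a j ∧ not ⌊ i ≟ᶠ j ⌋

    remove-self : ∀ a i → remove a i i ≡ false
    remove-self a i with i ≟ᶠ i | a i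
    ... | yes _  | true  = refl
    ... | yes _  | false = refl
    ... | no i≢i | _     = contradiction refl i≢i

    remove-other : ∀ a i j → j ≢ i → remove a i j ≡ a j
    remove-other a i j j≢i with i ≟ᶠ j | a j
    ... | yes i≡j | _     = contradiction (sym i≡j) j≢i
    ... | no _    | true  = refl
    ... | no _    | false = refl

    -- Every next letter is first given weight t, and those smaller than `x` are corrected by 1 - t;
    -- this is the shape of the recursion of `ascentSum`. A tie would break it, having no ascent and
    -- no correction.
    ascent-weight : ∀ (x i : Fin m) → x ≢ i →
      t ^ℚ (if ⌊ toℕ x ℕ.<? toℕ i ⌋ then 1 else 0) ≡ t + (1ℚ - t) * 𝟙 (toℕ i ℕ.<ᵇ toℕ x)
    ascent-weight x i x≢i with toℕ x ℕ.<? toℕ i | toℕ i ℕ.<ᵇ toℕ x in eq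
    ... | yes x<i | false = solve 1 (λ t → t :* con 1ℚ := t :+ (con 1ℚ :- t) :* con 0ℚ) refl t
    ... | yes x<i | true  = contradiction x<i (ℕₚ.<⇒≯ (ℕₚ.<ᵇ⇒< (toℕ i) (toℕ x) (subst Bool.T (sym eq) _)))
    ... | no  x≮i | true  = solve 1 (λ t → con 1ℚ := t :+ (con 1ℚ :- t) :* con 1ℚ) refl t
    ... | no  x≮i | false = contradiction (toℕ-injective (ℕₚ.≤-antisym
            (ℕₚ.≮⇒≥ (λ i<x → subst Bool.T eq (ℕₚ.<⇒<ᵇ i<x))) (ℕₚ.≮⇒≥ x≮i))) x≢i

    arrangements-suc : ∀ a x n → arrangements a x (suc n) ≡
      ΣFin m (λ i → 𝟙 (a i) * t ^ℚ (if ⌊ toℕ x ℕ.<? toℕ i ⌋ then 1 else 0) * arrangements (remove a i) i n)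
    arrangements-suc a x n = ΣFin-cong m (λ i → trans (sumVec-cong m n (λ w → lem i (toList w)))
      (sumVec-*ˡ m n (𝟙 (a i) * t ^ℚ c i) (λ w → 𝟙 (allB (remove a i) (toList w)) * 𝟙 (distinct (toList w)) * t ^ℚ ascents (i List.∷ toList w))))
      where
      c : Fin m → ℕ
      c i = if ⌊ toℕ x ℕ.<? toℕ i ⌋ then 1 else 0
      lem : ∀ i l → 𝟙 (a i ∧ allB a l) * 𝟙 (allB (λ y → not ⌊ i ≟ᶠ y ⌋) l ∧ distinct l) * t ^ℚ (c i ℕ.+ ascents (i List.∷ l)) ≡
        𝟙 (a i) * t ^ℚ c i * (𝟙 (allB (remove a i) l) * 𝟙 (distinct l) * t ^ℚ ascents (i List.∷ l))
      lem i l = begin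
        𝟙 (a i ∧ allB a l) * 𝟙 (allB (λ y → not ⌊ i ≟ᶠ y ⌋) l ∧ distinct l) * t ^ℚ (c i ℕ.+ ascents (i List.∷ l))
          ≡⟨ cong₂ _*_ (cong₂ _*_ (𝟙-∧ (a i) (allB a l)) (𝟙-∧ (allB (λ y → not ⌊ i ≟ᶠ y ⌋) l) (distinct l))) (^ℚ-+ (c i) (ascents (i List.∷ l)) t) ⟩
        𝟙 (a i) * A * (B * D) * (X * Y)
          ≡⟨ solve 6 (λ i a b d x y → i :* a :* (b :* d) :* (x :* y) := i :* x :* ((a :* b) :* d :* y)) refl (𝟙 (a i)) A B D X Y ⟩
        𝟙 (a i) * X * ((A * B) * D * Y)
          ≡⟨ cong (λ z → 𝟙 (a i) * X * (z * D * Y)) (sym (allB-∧ a (λ y → not ⌊ i ≟ᶠ y ⌋) l)) ⟩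
        𝟙 (a i) * X * (𝟙 (allB (remove a i) l) * D * Y) ∎
        where
        A B D X Y : ℚ
        A = 𝟙 (allB a l)
        B = 𝟙 (allB (λ y → not ⌊ i ≟ᶠ y ⌋) l)
        D = 𝟙 (distinct l)
        X = t ^ℚ c i
        Y = t ^ℚ ascents (i List.∷ l)

    -- Choosing the next letter and removing it from the mask lowers the count by one and keeps that
    -- letter's rank, so the two statements prove each other. The condition `a x ≡ false` rules out
    -- ties with the fixed letter.
    arrangements≡ascentSum : ∀ n a x → a x ≡ false → count a ≡ n → arrangements a x n ≡ ascentSum t n (below a x)
    remove≡ascentSum : ∀ n a i → a i ≡ true → count a ≡ suc n → arrangements (remove a i) i n ≡ ascentSum t n (below a i)

    arrangements≡ascentSum zero    a x _  _  = refl
    arrangements≡ascentSum (suc n) a x ax≡false ∣a∣≡n = begin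
      arrangements a x (suc n) ≡⟨ arrangements-suc a x n ⟩
      ΣFin m (λ i → 𝟙 (a i) * t ^ℚ (if ⌊ toℕ x ℕ.<? toℕ i ⌋ then 1 else 0) * arrangements (remove a i) i n)
        ≡⟨ ΣFin-cong m term ⟩
      ΣFin m (λ i → t * y i + (1ℚ - t) * (z i * y i)) ≡⟨ ΣFin-+ m (λ i → t * y i) (λ i → (1ℚ - t) * (z i * y i)) ⟩
      ΣFin m (λ i → t * y i) + ΣFin m (λ i → (1ℚ - t) * (z i * y i))
        ≡⟨ cong₂ _+_ (ΣFin-*ˡ m t y) (ΣFin-*ˡ m (1ℚ - t) (λ i → z i * y i)) ⟩
      t * ΣFin m y + (1ℚ - t) * ΣFin m (λ i → z i * y i)
        ≡⟨ cong₂ (λ u v → t * u + (1ℚ - t) * v) (trans (ΣFin-below m a (ascentSum t n)) (cong (λ k → ∑ k (ascentSum t n)) ∣a∣≡n)) (ΣFin-below-< m a (ascentSum t n) x) ⟩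
      ascentSum t (suc n) (below a x) ∎
      where
      y z : Fin m → ℚ
      y i = 𝟙 (a i) * ascentSum t n (below a i)
      z i = 𝟙 (toℕ i ℕ.<ᵇ toℕ x)
      term : ∀ i → 𝟙 (a i) * t ^ℚ (if ⌊ toℕ x ℕ.<? toℕ i ⌋ then 1 else 0) * arrangements (remove a i) i n ≡ t * y i + (1ℚ - t) * (z i * y i)
      term i = by-cases (a i) refl
        where
        by-cases : ∀ b → a i ≡ b → 𝟙 (a i) * t ^ℚ (if ⌊ toℕ x ℕ.<? toℕ i ⌋ then 1 else 0) * arrangements (remove a i) i n ≡ t * y i + (1ℚ - t) * (z i * y i)
        by-cases true ai≡true = trans
          (cong₂ (λ u v → 𝟙 (a i) * u * v)
            (ascent-weight x i (λ x≡i → contradiction (trans (sym ax≡false) (trans (cong a x≡i) ai≡true)) (λ ())))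
            (remove≡ascentSum n a i ai≡true ∣a∣≡n))
          (solve 4 (λ b t z g → b :* (t :+ (con 1ℚ :- t) :* z) :* g := t :* (b :* g) :+ (con 1ℚ :- t) :* (z :* (b :* g)))
            refl (𝟙 (a i)) t (z i) (ascentSum t n (below a i)))
        by-cases false ai≡false = trans
          (cong (λ b → 𝟙 b * X * Y) ai≡false)
          (trans (solve 5 (λ X Y t z g → con 0ℚ :* X :* Y := t :* (con 0ℚ :* g) :+ (con 1ℚ :- t) :* (z :* (con 0ℚ :* g)))
                   refl X Y t (z i) (ascentSum t n (below a i)))
            (cong (λ b → t * (𝟙 b * ascentSum t n (below a i)) + (1ℚ - t) * (z i * (𝟙 b * ascentSum t n (below a i)))) (sym ai≡false)))
          where
          X Y : ℚ
          X = t ^ℚ (if ⌊ toℕ x ℕ.<? toℕ i ⌋ then 1 else 0)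
          Y = arrangements (remove a i) i n

    remove≡ascentSum n a i ai≡true ∣a∣≡1+n = trans
      (arrangements≡ascentSum n (remove a i) i (remove-self a i)
        (ℕₚ.suc-injective (trans (sym (count-remove i ai≡true (remove-self a i) (remove-other a i))) ∣a∣≡1+n)))
      (cong (ascentSum t n) (below-remove i (remove-other a i)))

  sum-weight≡ascentSum : ∀ t n → sumVec n n (λ v → weight t (toList v)) ≡ ascentSum t n n
  sum-weight≡ascentSum t zero    = refl
  sum-weight≡ascentSum t (suc n) = begin
    sumVec (suc n) (suc n) (λ v → weight t (toList v))
      ≡⟨ ΣFin-cong (suc n) (λ i → sumVec-cong (suc n) n (λ w → cong (_* t ^ℚ ascents (i List.∷ toList w))
            (𝟙-∧ (allB (λ y → not ⌊ i ≟ᶠ y ⌋) (toList w)) (distinct (toList w))))) ⟩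
    -- Distinctness of the first letter from the tail is, by computation, membership in the full
    -- mask with `i` removed.
    ΣFin (suc n) (λ i → arrangements t (remove t (λ _ → true) i) i n)
      ≡⟨ ΣFin-cong (suc n) (λ i → trans (remove≡ascentSum t n (λ _ → true) i refl (count-true (suc n))) (sym (*-identityˡ _))) ⟩
    ΣFin (suc n) (λ i → 𝟙 true * ascentSum t n (below (λ _ → true) i)) ≡⟨ ΣFin-below (suc n) (λ _ → true) (ascentSum t n) ⟩
    ∑ (count {suc n} (λ _ → true)) (ascentSum t n) ≡⟨ cong (λ k → ∑ k (ascentSum t n)) (count-true (suc n)) ⟩
    ∑ (suc n) (ascentSum t n) ≡⟨ sym (ascentSum-diagonal t n) ⟩
    ascentSum t (suc n) (suc n) ∎

  ascentSum-1≡! : ∀ n k → ascentSum 1ℚ n k ≡ ℕ→ℚ (n !)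
  ascentSum-1≡! zero    k = refl
  ascentSum-1≡! (suc n) k = begin
    1ℚ * ∑ (suc n) (ascentSum 1ℚ n) + 0ℚ * ∑ k (ascentSum 1ℚ n)
      ≡⟨ solve 2 (λ a b → con 1ℚ :* a :+ con 0ℚ :* b := a) refl (∑ (suc n) (ascentSum 1ℚ n)) (∑ k (ascentSum 1ℚ n)) ⟩
    ∑ (suc n) (ascentSum 1ℚ n) ≡⟨ ∑-cong (suc n) (λ j _ → trans (ascentSum-1≡! n j) (sym (*-identityʳ (ℕ→ℚ (n !))))) ⟩
    ∑ (suc n) (λ _ → ℕ→ℚ (n !) * 1ℚ) ≡⟨ trans (∑-*ˡ (suc n) (ℕ→ℚ (n !)) (λ _ → 1ℚ)) (cong (ℕ→ℚ (n !) *_) (∑-const-1 (suc n))) ⟩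
    ℕ→ℚ (n !) * ℕ→ℚ (suc n) ≡⟨ trans (*-comm (ℕ→ℚ (n !)) (ℕ→ℚ (suc n))) (sym (ℕ→ℚ-* (suc n) (n !))) ⟩
    ℕ→ℚ (suc n !) ∎

  -- Even minus odd numbers of ascents

  altEulerian : ℕ → ℚ
  altEulerian n = ascentSum (- 1ℚ) n n

  -- Unroll `F n (n + k)` n times: each time the row stays or drops by one with a factor 2, so row i
  -- is reached in C(n,i) ways with weight 2ⁿ⁻ⁱ.
  conv-2^-shift : ∀ (F : ℕ → ℕ → ℚ) → (∀ n k → F (suc n) (suc k) ≡ F (suc n) k + 2ℚ * F n k) →
    ∀ n k → conv (2ℚ ^ℚ_) (λ i → F i k) n ≡ F n (n ℕ.+ k)
  conv-2^-shift F step zero    k = *-identityˡ (F 0 k)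
  conv-2^-shift F step (suc n) k = begin
    conv (λ j → 2ℚ * 2ℚ ^ℚ j) (λ i → F i k) n + conv (2ℚ ^ℚ_) (λ i → F (suc i) k) n
      ≡⟨ cong₂ _+_ (trans (conv-scaleˡ n 2ℚ (2ℚ ^ℚ_) (λ i → F i k)) (cong (2ℚ *_) (conv-2^-shift F step n k)))
           (conv-2^-shift (F ∘ suc) (step ∘ suc) n k) ⟩
    2ℚ * F n (n ℕ.+ k) + F (suc n) (n ℕ.+ k) ≡⟨ +-comm (2ℚ * F n (n ℕ.+ k)) (F (suc n) (n ℕ.+ k)) ⟩
    F (suc n) (n ℕ.+ k) + 2ℚ * F n (n ℕ.+ k) ≡⟨ sym (step n (n ℕ.+ k)) ⟩
    F (suc n) (suc n ℕ.+ k) ∎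

  -- Raising the rank only lengthens the correction sum by one term, whose factor 1 - t is 2 at t =
  -- -1.
  ascentSum-step : ∀ n k → ascentSum (- 1ℚ) (suc n) (suc k) ≡ ascentSum (- 1ℚ) (suc n) k + 2ℚ * ascentSum (- 1ℚ) n k
  ascentSum-step n k = solve 3 (λ a b c → con (- 1ℚ) :* a :+ con 2ℚ :* (b :+ c) := con (- 1ℚ) :* a :+ con 2ℚ :* b :+ con 2ℚ :* c)
    refl (∑ (suc n) (ascentSum (- 1ℚ) n)) (∑ k (ascentSum (- 1ℚ) n)) (ascentSum (- 1ℚ) n k)

  -- Below all other letters the fixed letter forces an ascent, of weight -1. With no other letter
  -- there is no step and the value is 1 = 2 - 1, which explains the `δ` term.
  ascentSum-0 : ∀ n → ascentSum (- 1ℚ) n 0 ≡ 2ℚ * δ n + - 1ℚ * altEulerian n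
  ascentSum-0 zero    = refl
  ascentSum-0 (suc n) = trans (solve 1 (λ a → con (- 1ℚ) :* a :+ con 2ℚ :* con 0ℚ := con 2ℚ :* con 0ℚ :+ con (- 1ℚ) :* a) refl (∑ (suc n) (ascentSum (- 1ℚ) n)))
    (cong (λ z → 2ℚ * 0ℚ + - 1ℚ * z) (sym (ascentSum-diagonal (- 1ℚ) n)))

  -- Joins the two ends of a row as E(z) = e²ᶻ(2 - E(z)). Thus E(z) = 1 + tanh z, and the values for
  -- n ≥ 1 are the signed tangent numbers.
  altEulerian-functional : ∀ n → conv altEulerian (2ℚ ^ℚ_) n + altEulerian n ≡ 2ℚ * 2ℚ ^ℚ n
  altEulerian-functional n = begin
    E₂ + altEulerian n ≡⟨ cong (λ k → E₂ + ascentSum (- 1ℚ) n k) (sym (ℕₚ.+-identityʳ n)) ⟩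
    E₂ + ascentSum (- 1ℚ) n (n ℕ.+ 0) ≡⟨ cong (E₂ +_) (sym (conv-2^-shift (ascentSum (- 1ℚ)) ascentSum-step n 0)) ⟩
    E₂ + conv (2ℚ ^ℚ_) (λ i → ascentSum (- 1ℚ) i 0) n ≡⟨ cong (E₂ +_) (conv-cong n {2ℚ ^ℚ_} (λ _ → refl) ascentSum-0) ⟩
    E₂ + conv (2ℚ ^ℚ_) (λ i → 2ℚ * δ i + - 1ℚ * altEulerian i) n ≡⟨ cong (E₂ +_) (conv-distribˡ n (2ℚ ^ℚ_) (λ i → 2ℚ * δ i) (λ i → - 1ℚ * altEulerian i)) ⟩
    E₂ + (conv (2ℚ ^ℚ_) (λ i → 2ℚ * δ i) n + conv (2ℚ ^ℚ_) (λ i → - 1ℚ * altEulerian i) n)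
      ≡⟨ cong (E₂ +_) (cong₂ _+_ (trans (conv-scaleʳ n 2ℚ (2ℚ ^ℚ_) δ) (cong (2ℚ *_) (conv-identityʳ n (2ℚ ^ℚ_))))
           (trans (conv-scaleʳ n (- 1ℚ) (2ℚ ^ℚ_) altEulerian) (cong (- 1ℚ *_) (conv-comm n (2ℚ ^ℚ_) altEulerian)))) ⟩
    E₂ + (2ℚ * 2ℚ ^ℚ n + - 1ℚ * E₂) ≡⟨ solve 2 (λ c b → c :+ (b :+ con (- 1ℚ) :* c) := b) refl E₂ (2ℚ * 2ℚ ^ℚ n) ⟩
    2ℚ * 2ℚ ^ℚ n ∎
    where
    E₂ : ℚ
    E₂ = conv altEulerian (2ℚ ^ℚ_) n

  -- The identity permutation and the value of M

  allB-tabulate : ∀ {A : Set} (P : A → Bool) n (f : Fin n → A) → (∀ i → P (f i) ≡ true) → allB P (toList (tabulate f)) ≡ true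
  allB-tabulate P zero    f e = refl
  allB-tabulate P (suc n) f e rewrite e Fin.zero = allB-tabulate P n (f ∘ Fin.suc) (e ∘ Fin.suc)

  distinct-tabulate : ∀ n {k} (f : Fin n → Fin k) → (∀ {i j} → f i ≡ f j → i ≡ j) → distinct (toList (tabulate f)) ≡ true
  distinct-tabulate zero    f inj = refl
  distinct-tabulate (suc n) f inj = cong₂ _∧_
    (allB-tabulate (λ y → not ⌊ f Fin.zero ≟ᶠ y ⌋) n (f ∘ Fin.suc) f0≢)
    (distinct-tabulate n (f ∘ Fin.suc) (Finₚ.suc-injective ∘ inj))
    where
    f0≢ : ∀ i → not ⌊ f Fin.zero ≟ᶠ f (Fin.suc i) ⌋ ≡ true
    f0≢ i with f Fin.zero ≟ᶠ f (Fin.suc i)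
    ... | no  _ = refl
    ... | yes e with () ← inj e

  ascents-tabulate : ∀ n {k} (f : Fin (suc n) → Fin k) → (∀ {i j} → i Fin.< j → f i Fin.< f j) → ascents (toList (tabulate f)) ≡ n
  ascents-tabulate zero    f mono = refl
  ascents-tabulate (suc n) f mono with toℕ (f Fin.zero) ℕ.<? toℕ (f (Fin.suc Fin.zero))
  ... | yes _  = cong suc (ascents-tabulate n (f ∘ Fin.suc) (λ i<j → mono (s≤s i<j)))
  ... | no ¬lt = contradiction (mono (s≤s z≤n)) ¬lt

  1+neg1^ : ∀ n → 2ℚ * 𝟙 (isEven n) ≡ 1ℚ + (- 1ℚ) ^ℚ n
  1+neg1^ zero          = refl
  1+neg1^ (suc zero)    = refl
  1+neg1^ (suc (suc n)) = trans (1+neg1^ n) (solve 1 (λ x → con 1ℚ :+ x := con 1ℚ :+ con (- 1ℚ) :* (con (- 1ℚ) :* x)) refl ((- 1ℚ) ^ℚ n))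

  -- The weights at t = 1 and t = -1 add up to twice the indicator of an even number of ascents. The
  -- identity on `suc m` letters has m ascents, so for even m it lies in the even class, and
  -- restoring it costs the summand 2.
  2M+2 : ∀ m → isEven m ≡ true → 2ℚ * ℕ→ℚ (M (suc m)) + 2ℚ ≡ ℕ→ℚ (suc m !) + altEulerian (suc m)
  2M+2 m m-even = begin
    2ℚ * ℕ→ℚ (M s) + 2ℚ
      ≡⟨ cong₂ (λ x y → 2ℚ * x + 2ℚ * y) (countVec≡sumVec s s (countedByM s)) (sym W-id) ⟩
    2ℚ * sumVec s s (𝟙 ∘ countedByM s) + 2ℚ * W ι
      ≡⟨ trans (sym (*-distribˡ-+ 2ℚ (sumVec s s (𝟙 ∘ countedByM s)) (W ι))) (cong (λ z → 2ℚ * (sumVec s s (𝟙 ∘ countedByM s) + z)) (sym (sumVec-single s s ι W))) ⟩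
    2ℚ * (sumVec s s (𝟙 ∘ countedByM s) + sumVec s s (λ v → 𝟙 (e v) * W v))
      ≡⟨ cong (2ℚ *_) (trans (sym (sumVec-+ s s (𝟙 ∘ countedByM s) (λ v → 𝟙 (e v) * W v))) (sumVec-cong s s merge)) ⟩
    2ℚ * sumVec s s W ≡⟨ sym (sumVec-*ˡ s s 2ℚ W) ⟩
    sumVec s s (λ v → 2ℚ * W v) ≡⟨ sumVec-cong s s split ⟩
    sumVec s s (λ v → weight 1ℚ (toList v) + weight (- 1ℚ) (toList v))
      ≡⟨ sumVec-+ s s (λ v → weight 1ℚ (toList v)) (λ v → weight (- 1ℚ) (toList v)) ⟩
    sumVec s s (λ v → weight 1ℚ (toList v)) + sumVec s s (λ v → weight (- 1ℚ) (toList v))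
      ≡⟨ cong₂ _+_ (trans (sum-weight≡ascentSum 1ℚ s) (ascentSum-1≡! s s)) (sum-weight≡ascentSum (- 1ℚ) s) ⟩
    ℕ→ℚ (s !) + altEulerian s ∎
    where
    s : ℕ
    s = suc m
    ι : Vec (Fin s) s
    ι = allFin s
    e : Vec (Fin s) s → Bool
    e v = ⌊ ≡-dec _≟ᶠ_ v ι ⌋
    W : Vec (Fin s) s → ℚ
    W v = 𝟙 (distinct (toList v) ∧ isEven (ascents (toList v)))
    W-id : W ι ≡ 1ℚ
    W-id = cong₂ (λ a b → 𝟙 (a ∧ b)) (distinct-tabulate s id id) (trans (cong isEven (ascents-tabulate m id id)) m-even)
    ∧-split : ∀ a b c → 𝟙 (a ∧ b ∧ not c) + 𝟙 c * 𝟙 (a ∧ b) ≡ 𝟙 (a ∧ b)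
    ∧-split true  true  true  = refl
    ∧-split true  true  false = refl
    ∧-split true  false true  = refl
    ∧-split true  false false = refl
    ∧-split false b     true  = refl
    ∧-split false b     false = refl
    merge : ∀ v → 𝟙 (countedByM s v) + 𝟙 (e v) * W v ≡ W v
    merge v = ∧-split (distinct (toList v)) (isEven (ascents (toList v))) (e v)
    split : ∀ v → 2ℚ * W v ≡ weight 1ℚ (toList v) + weight (- 1ℚ) (toList v)
    split v = begin
      2ℚ * W v ≡⟨ cong (2ℚ *_) (𝟙-∧ (distinct l) (isEven (ascents l))) ⟩
      2ℚ * (D * 𝟙 (isEven (ascents l))) ≡⟨ solve 2 (λ d x → con 2ℚ :* (d :* x) := d :* (con 2ℚ :* x)) refl D (𝟙 (isEven (ascents l))) ⟩
      D * (2ℚ * 𝟙 (isEven (ascents l))) ≡⟨ cong (D *_) (trans (1+neg1^ (ascents l)) (cong (_+ (- 1ℚ) ^ℚ ascents l) (sym (1^ℚ (ascents l))))) ⟩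
      D * (1ℚ ^ℚ ascents l + (- 1ℚ) ^ℚ ascents l) ≡⟨ *-distribˡ-+ D (1ℚ ^ℚ ascents l) ((- 1ℚ) ^ℚ ascents l) ⟩
      weight 1ℚ l + weight (- 1ℚ) l ∎
      where
      l : List (Fin s)
      l = toList v
      D : ℚ
      D = 𝟙 (distinct l)

module Modular where

  open import Data.Integer as ℤ using (ℤ)
  import Data.Integer.Properties as ℤₚ
  open import Data.Nat as ℕ using (ℕ; zero; suc; _<_; _≤_; _∸_; z≤n; s≤s; _!)
  open import Data.Nat.Combinatorics using (_C_)
  open import Data.Nat.Divisibility using (_∣_; divides; _∣0; ∣⇒≤; ∣1⇒≡1)
  open import Data.Nat.Primality using (Prime; euclidsLemma; prime⇒nonTrivial)
  import Data.Nat.Properties as ℕₚ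
  open import Data.Rational using (ℚ; _+_; _-_; _*_; -_; 0ℚ; 1ℚ; ↥_; ↧ₙ_; ↧_)
  open import Data.Rational.Properties hiding (_<?_; _≟_)
  open import Data.Rational.Solver using (module +-*-Solver)
  open import Data.Sum using (inj₁; inj₂; [_,_]′)
  open import Function using (_∘_; id)
  open import Level using (0ℓ)
  open import Relation.Binary.Bundles using (Setoid)
  import Relation.Binary.Reasoning.Setoid as SetoidReasoning
  open import Relation.Nullary using (¬_; contradiction)
  open +-*-Solver using (solve; _:+_; _:*_; :-_; _:-_; _:=_; con)
  open Exact

  -- Rationals integral at p and congruence modulo p

  module Mod (r : ℕ) (p-prime : Prime (suc r)) where

    p : ℕ
    p = suc r

    P : ℚ
    P = ℕ→ℚ p

    p∤1 : ¬ p ∣ 1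
    p∤1 p∣1 = ℕₚ.<⇒≢ (ℕ.nonTrivial⇒n>1 p ⦃ prime⇒nonTrivial p-prime ⦄) (sym (∣1⇒≡1 p∣1))

    p∤* : ∀ {a b} → ¬ p ∣ a → ¬ p ∣ b → ¬ p ∣ a ℕ.* b
    p∤* {a} {b} p∤a p∤b p∣ab with euclidsLemma a b p-prime p∣ab
    ... | inj₁ p∣a = p∤a p∣a
    ... | inj₂ p∣b = p∤b p∣b

    p∤suc : ∀ {k} → suc k < p → ¬ p ∣ suc k
    p∤suc k<p p∣k = ℕₚ.<⇒≱ k<p (∣⇒≤ p∣k)

    -- Any denominator prime to p may serve as witness, not only the reduced one. Sums and products
    -- then just multiply denominators, and Euclid's lemma keeps them prime to p; 0 is excluded
    -- because p divides it.
    record Integral (x : ℚ) : Set where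
      constructor integral
      field
        {denom} : ℕ
        {numer} : ℤ
        p∤denom : ¬ p ∣ denom
        cleared : x * ℕ→ℚ denom ≡ ℤ→ℚ numer

    ℤ-integral : ∀ i → Integral (ℤ→ℚ i)
    ℤ-integral i = integral {denom = 1} {i} p∤1 (*-identityʳ (ℤ→ℚ i))

    ℕ-integral : ∀ n → Integral (ℕ→ℚ n)
    ℕ-integral n = ℤ-integral (ℤ.+ n)

    0-integral : Integral 0ℚ
    0-integral = ℕ-integral 0

    1-integral : Integral 1ℚ
    1-integral = ℕ-integral 1

    +-integral : ∀ {x y} → Integral x → Integral y → Integral (x + y)
    +-integral {x} {y} (integral {d} {a} p∤d ex) (integral {e} {b} p∤e ey) =
      integral {denom = d ℕ.* e} {a ℤ.* ℤ.+ e ℤ.+ b ℤ.* ℤ.+ d} (p∤* p∤d p∤e) (begin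
        (x + y) * ℕ→ℚ (d ℕ.* e) ≡⟨ cong ((x + y) *_) (ℕ→ℚ-* d e) ⟩
        (x + y) * (D * E) ≡⟨ solve 4 (λ x y d e → (x :+ y) :* (d :* e) := x :* d :* e :+ y :* e :* d) refl x y D E ⟩
        x * D * E + y * E * D ≡⟨ cong₂ (λ u v → u * E + v * D) ex ey ⟩
        ℤ→ℚ a * E + ℤ→ℚ b * D ≡⟨ cong₂ _+_ (sym (ℤ→ℚ-* a (ℤ.+ e))) (sym (ℤ→ℚ-* b (ℤ.+ d))) ⟩
        ℤ→ℚ (a ℤ.* ℤ.+ e) + ℤ→ℚ (b ℤ.* ℤ.+ d) ≡⟨ sym (ℤ→ℚ-+ (a ℤ.* ℤ.+ e) (b ℤ.* ℤ.+ d)) ⟩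
        ℤ→ℚ (a ℤ.* ℤ.+ e ℤ.+ b ℤ.* ℤ.+ d) ∎)
      where
      open ≡-Reasoning
      D E : ℚ
      D = ℕ→ℚ d
      E = ℕ→ℚ e

    *-integral : ∀ {x y} → Integral x → Integral y → Integral (x * y)
    *-integral {x} {y} (integral {d} {a} p∤d ex) (integral {e} {b} p∤e ey) =
      integral {denom = d ℕ.* e} {a ℤ.* b} (p∤* p∤d p∤e) (begin
        x * y * ℕ→ℚ (d ℕ.* e) ≡⟨ cong (x * y *_) (ℕ→ℚ-* d e) ⟩
        x * y * (ℕ→ℚ d * ℕ→ℚ e) ≡⟨ solve 4 (λ x y d e → x :* y :* (d :* e) := x :* d :* (y :* e)) refl x y (ℕ→ℚ d) (ℕ→ℚ e) ⟩
        x * ℕ→ℚ d * (y * ℕ→ℚ e) ≡⟨ cong₂ _*_ ex ey ⟩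
        ℤ→ℚ a * ℤ→ℚ b ≡⟨ sym (ℤ→ℚ-* a b) ⟩
        ℤ→ℚ (a ℤ.* b) ∎)
      where open ≡-Reasoning

    neg-integral : ∀ {x} → Integral x → Integral (- x)
    neg-integral {x} (integral {d} {a} p∤d ex) = integral {denom = d} {ℤ.- a} p∤d
      (trans (sym (neg-distribˡ-* x (ℕ→ℚ d))) (trans (cong -_ ex) (sym (ℤ→ℚ-neg a))))

    inv-integral : ∀ {d} → ¬ p ∣ d → Integral (inv d)
    inv-integral {zero}  p∤d = 0-integral
    inv-integral {suc d} p∤d = integral {denom = suc d} {ℤ.+ 1} p∤d (trans (*-comm (inv (suc d)) (ℕ→ℚ (suc d))) (n*inv[n]≡1 d))

    ^-integral : ∀ {x} → Integral x → ∀ n → Integral (x ^ℚ n)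
    ^-integral ix zero    = 1-integral
    ^-integral ix (suc n) = *-integral ix (^-integral ix n)

    ∑-integral : ∀ n {f} → (∀ k → k < n → Integral (f k)) → Integral (∑ n f)
    ∑-integral zero    _  = 0-integral
    ∑-integral (suc n) if = +-integral (∑-integral n (λ k k<n → if k (ℕₚ.m<n⇒m<1+n k<n))) (if n ℕₚ.≤-refl)

    infix 4 _≈_
    -- The two sides need not be integral themselves, so 1/p and Bₚ₋₁ may occur in them; in return a
    -- congruence may be multiplied only by integral factors.
    record _≈_ (x y : ℚ) : Set where
      constructor congruent
      field
        {quotient} : ℚ
        quotient-integral : Integral quotient
        equation : x ≡ y + P * quotient

    ≈-reflexive : ∀ {x y} → x ≡ y → x ≈ y
    ≈-reflexive {x} refl = congruent 0-integral (solve 2 (λ x p → x := x :+ p :* con 0ℚ) refl x P)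

    ≈-refl : ∀ {x} → x ≈ x
    ≈-refl = ≈-reflexive refl

    ≈-sym : ∀ {x y} → x ≈ y → y ≈ x
    ≈-sym {x} {y} (congruent {z} iz e) = congruent (neg-integral iz)
      (trans (solve 3 (λ y p z → y := y :+ p :* z :+ p :* (:- z)) refl y P z) (cong (_+ P * (- z)) (sym e)))

    ≈-trans : ∀ {x y z} → x ≈ y → y ≈ z → x ≈ z
    ≈-trans {z = z} (congruent {u} iu refl) (congruent {v} iv refl) = congruent (+-integral iu iv)
      (solve 4 (λ z p u v → z :+ p :* v :+ p :* u := z :+ p :* (u :+ v)) refl z P u v)

    ≈-setoid : Setoid 0ℓ 0ℓ
    ≈-setoid = record
      { Carrier = ℚ ; _≈_ = _≈_
      ; isEquivalence = record { refl = ≈-refl ; sym = ≈-sym ; trans = ≈-trans } }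

    module ≈-Reasoning = SetoidReasoning ≈-setoid

    +-≈ : ∀ {a b x y} → a ≈ b → x ≈ y → a + x ≈ b + y
    +-≈ {b = b} {y = y} (congruent {u} iu refl) (congruent {v} iv refl) = congruent (+-integral iu iv)
      (solve 5 (λ b y p u v → b :+ p :* u :+ (y :+ p :* v) := b :+ y :+ p :* (u :+ v)) refl b y P u v)

    neg-≈ : ∀ {x y} → x ≈ y → - x ≈ - y
    neg-≈ {y = y} (congruent {u} iu refl) = congruent (neg-integral iu)
      (solve 3 (λ y p u → :- (y :+ p :* u) := :- y :+ p :* (:- u)) refl y P u)

    *-≈ˡ : ∀ {c x y} → Integral c → x ≈ y → c * x ≈ c * y
    *-≈ˡ {c} {y = y} ic (congruent {u} iu refl) = congruent (*-integral ic iu)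
      (solve 4 (λ c y p u → c :* (y :+ p :* u) := c :* y :+ p :* (c :* u)) refl c y P u)

    *-≈ʳ : ∀ {c x y} → Integral c → x ≈ y → x * c ≈ y * c
    *-≈ʳ {c} {x} {y} ic x≈y = subst₂ _≈_ (*-comm c x) (*-comm c y) (*-≈ˡ ic x≈y)

    ∑-≈ : ∀ n {f g} → (∀ k → k < n → f k ≈ g k) → ∑ n f ≈ ∑ n g
    ∑-≈ zero    e = ≈-refl
    ∑-≈ (suc n) e = +-≈ (∑-≈ n (λ k k<n → e k (ℕₚ.m<n⇒m<1+n k<n))) (e n ℕₚ.≤-refl)

    P*≈0 : ∀ {x} → Integral x → P * x ≈ 0ℚ
    P*≈0 {x} ix = congruent ix (sym (+-identityˡ (P * x)))

    *-cancelˡ-≈ : ∀ {d x y} → ¬ p ∣ suc d → ℕ→ℚ (suc d) * x ≈ ℕ→ℚ (suc d) * y → x ≈ y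
    *-cancelˡ-≈ {d} {x} {y} p∤d e = subst₂ _≈_ (inv-*-cancel d x) (inv-*-cancel d y) (*-≈ˡ (inv-integral p∤d) e)

    -- Multiplying `w ≡ P * z` by both denominators gives an integer equation showing that p divides
    -- `↥ w` times `d`, and Euclid's lemma removes `d`.
    p∣numerator : ∀ w {z} → Integral z → w ≡ P * z → p ∣ ℤ.∣ ↥ w ∣
    p∣numerator w {z} (integral {d} {a} p∤d ez) e =
      [ id , (λ p∣d → contradiction p∣d p∤d) ]′
        (euclidsLemma ℤ.∣ ↥ w ∣ d p-prime (divides ℤ.∣ a ℤ.* ↧ w ∣ eqℕ))
      where
      open ≡-Reasoning
      W : ℚ
      W = ℕ→ℚ (↧ₙ w)
      eqℤ : ↥ w ℤ.* ℤ.+ d ≡ a ℤ.* ↧ w ℤ.* ℤ.+ p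
      eqℤ = ℤ→ℚ-injective (begin
        ℤ→ℚ (↥ w ℤ.* ℤ.+ d) ≡⟨ ℤ→ℚ-* (↥ w) (ℤ.+ d) ⟩
        ℤ→ℚ (↥ w) * ℕ→ℚ d ≡⟨ cong (_* ℕ→ℚ d) (sym (x*↧x≡↥x w)) ⟩
        w * W * ℕ→ℚ d ≡⟨ cong (λ v → v * W * ℕ→ℚ d) e ⟩
        P * z * W * ℕ→ℚ d ≡⟨ solve 4 (λ p z w d → p :* z :* w :* d := z :* d :* w :* p) refl P z W (ℕ→ℚ d) ⟩
        z * ℕ→ℚ d * W * P ≡⟨ cong (λ v → v * W * P) ez ⟩
        ℤ→ℚ a * W * P ≡⟨ cong (_* P) (sym (ℤ→ℚ-* a (↧ w))) ⟩
        ℤ→ℚ (a ℤ.* ↧ w) * P ≡⟨ sym (ℤ→ℚ-* (a ℤ.* ↧ w) (ℤ.+ p)) ⟩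
        ℤ→ℚ (a ℤ.* ↧ w ℤ.* ℤ.+ p) ∎)
      eqℕ : ℤ.∣ ↥ w ∣ ℕ.* d ≡ ℤ.∣ a ℤ.* ↧ w ∣ ℕ.* p
      eqℕ = trans (sym (ℤₚ.abs-* (↥ w) (ℤ.+ d))) (trans (cong ℤ.∣_∣ eqℤ) (ℤₚ.abs-* (a ℤ.* ↧ w) (ℤ.+ p)))

    ≈⇒modℚ : ∀ {x y} → x ≈ y → x ≡ y [modℚ p ]
    ≈⇒modℚ {x} {y} (congruent {z} iz e) = p∣numerator (x - y) iz
      (trans (cong (_- y) e) (solve 2 (λ y u → y :+ u :- y := u) refl y (P * z)))

    conv-integral : ∀ n {f g} → (∀ k → Integral (f k)) → (∀ k → Integral (g k)) → Integral (conv f g n)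
    conv-integral zero    if ig = *-integral (if 0) (ig 0)
    conv-integral (suc n) if ig = +-integral (conv-integral n (if ∘ suc) ig) (conv-integral n if (ig ∘ suc))

    conv-≈ : ∀ n {f g h} → (∀ k → Integral (f k)) → (∀ k → g k ≈ h k) → conv f g n ≈ conv f h n
    conv-≈ zero    if e = *-≈ˡ (if 0) (e 0)
    conv-≈ (suc n) if e = +-≈ (conv-≈ n (if ∘ suc) e) (conv-≈ n if (e ∘ suc))

    -- Binomial coefficients and Fermat's little theorem modulo p

    binom-integral : ∀ n k → Integral (binom n k)
    binom-integral n k = ℕ-integral (n C k)

    binom-p≈0 : ∀ k → suc k < p → binom p (suc k) ≈ 0ℚ
    binom-p≈0 k k<p = ≈-trans (≈-reflexive (binom-suc-suc r k))
      (P*≈0 (*-integral (inv-integral (p∤suc k<p)) (binom-integral r k)))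

    frobenius : ∀ n → (1ℚ + ℕ→ℚ n) ^ℚ p ≈ 1ℚ + ℕ→ℚ n ^ℚ p
    frobenius n = begin
      (1ℚ + N) ^ℚ p ≡⟨ sym (conv-exp p 1ℚ N) ⟩
      conv (1ℚ ^ℚ_) (N ^ℚ_) p ≡⟨ conv≡∑ p (1ℚ ^ℚ_) (N ^ℚ_) ⟩
      ∑ p h + h p ≡⟨ cong (_+ h p) (∑-head r h) ⟩
      h 0 + ∑ r (h ∘ suc) + h p ≈⟨ +-≈ (+-≈ (≈-refl {h 0}) mid) (≈-refl {h p}) ⟩
      h 0 + 0ℚ + h p ≡⟨ cong₂ (λ u v → u + 0ℚ + v) e₀ eₚ ⟩
      N ^ℚ p + 0ℚ + 1ℚ ≡⟨ solve 1 (λ a → a :+ con 0ℚ :+ con 1ℚ := con 1ℚ :+ a) refl (N ^ℚ p) ⟩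
      1ℚ + N ^ℚ p ∎
      where
      open ≈-Reasoning
      N : ℚ
      N = ℕ→ℚ n
      h : ℕ → ℚ
      h k = binom p k * (1ℚ ^ℚ k * N ^ℚ (p ∸ k))
      e₀ : h 0 ≡ N ^ℚ p
      e₀ = trans (cong (_* (1ℚ * N ^ℚ p)) (binom-n-0 p)) (trans (*-identityˡ _) (*-identityˡ (N ^ℚ p)))
      eₚ : h p ≡ 1ℚ
      eₚ = cong₂ _*_ (binom-n-n p) (cong₂ (λ a b → a * N ^ℚ b) (1^ℚ p) (ℕₚ.n∸n≡0 p))
      mid : ∑ r (h ∘ suc) ≈ 0ℚ
      mid = ≈-trans (∑-≈ r (λ k k<r → ≈-trans (*-≈ʳ (*-integral (^-integral 1-integral (suc k)) (^-integral (ℕ-integral n) (p ∸ suc k))) (binom-p≈0 k (s≤s k<r)))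
                  (≈-reflexive (*-zeroˡ (1ℚ ^ℚ suc k * N ^ℚ (p ∸ suc k)))))) (≈-reflexive (∑-0 r))

    fermat : ∀ n → ℕ→ℚ n ^ℚ p ≈ ℕ→ℚ n
    fermat zero    = ≈-reflexive (*-zeroˡ (0ℚ ^ℚ r))
    fermat (suc n) = begin
      ℕ→ℚ (suc n) ^ℚ p ≡⟨ cong (_^ℚ p) (ℕ→ℚ-suc n) ⟩
      (1ℚ + ℕ→ℚ n) ^ℚ p ≈⟨ frobenius n ⟩
      1ℚ + ℕ→ℚ n ^ℚ p ≈⟨ +-≈ (≈-refl {1ℚ}) (fermat n) ⟩
      1ℚ + ℕ→ℚ n ≡⟨ sym (ℕ→ℚ-suc n) ⟩
      ℕ→ℚ (suc n) ∎
      where open ≈-Reasoning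

    fermat-unit : ∀ n → ¬ p ∣ suc n → ℕ→ℚ (suc n) ^ℚ r ≈ 1ℚ
    fermat-unit n p∤n = *-cancelˡ-≈ p∤n (≈-trans (fermat (suc n)) (≈-reflexive (sym (*-identityʳ (ℕ→ℚ (suc n))))))

    -- By Pascal's rule neighbouring entries of row p - 1 add up to an inner entry of row p, which
    -- is divisible by p, so the entries alternate in sign from 1 on.
    binom-r≈ : ∀ k → k < p → binom r k ≈ (- 1ℚ) ^ℚ k
    binom-r≈ zero    _   = ≈-reflexive (binom-n-0 r)
    binom-r≈ (suc k) k<p = begin
      binom r (suc k) ≡⟨ solve 2 (λ a b → b := a :+ b :- a) refl (binom r k) (binom r (suc k)) ⟩
      binom r k + binom r (suc k) - binom r k ≡⟨ cong (_- binom r k) (sym (binom-pascal r k)) ⟩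
      binom p (suc k) - binom r k ≈⟨ +-≈ (binom-p≈0 k k<p) (neg-≈ (binom-r≈ k (ℕₚ.<-trans (ℕₚ.n<1+n k) k<p))) ⟩
      0ℚ - (- 1ℚ) ^ℚ k ≡⟨ solve 1 (λ a → con 0ℚ :- a := con (- 1ℚ) :* a) refl ((- 1ℚ) ^ℚ k) ⟩
      (- 1ℚ) * (- 1ℚ) ^ℚ k ∎
      where open ≈-Reasoning

  -- Wilson's theorem for p = m + 3

  module OddPrime (m : ℕ) (p-prime : Prime (3 ℕ.+ m)) (m-even : (- 1ℚ) ^ℚ m ≡ 1ℚ) where

    s r : ℕ
    s = suc m
    r = suc s

    open Mod r p-prime public

    neg1^r : (- 1ℚ) ^ℚ r ≡ 1ℚ
    neg1^r = cong (λ z → - 1ℚ * (- 1ℚ * z)) m-even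

    p∤2 : ¬ p ∣ 2
    p∤2 = p∤suc (s≤s (s≤s (s≤s z≤n)))

    P≡1+r : P ≡ 1ℚ + ℕ→ℚ r
    P≡1+r = ℕ→ℚ-suc r

    -- (p-1)! is the (p-1)-st difference of xᵖ⁻¹ at 0. Modulo p the alternating signs cancel those
    -- of the binomial coefficients, Fermat turns p - 1 of the powers into 1, and the last one is a
    -- power of 0; the sum is p - 1.
    wilson : ℕ→ℚ (r !) ≈ - 1ℚ
    wilson = begin
      ℕ→ℚ (r !) ≡⟨ sym (difference-≡ r 0ℚ) ⟩
      difference r r 0ℚ ≡⟨ conv≡∑ r ((- 1ℚ) ^ℚ_) x ⟩
      ∑ p (λ k → binom r k * ((- 1ℚ) ^ℚ k * x (r ∸ k))) ≈⟨ ∑-≈ p (λ k k<p → step k k<p) ⟩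
      ∑ r (λ k → x (r ∸ k)) + x (r ∸ r) ≈⟨ +-≈ (∑-≈ r (λ k k<r → unit (r ∸ k) (ℕₚ.m<n⇒0<n∸m k<r) (s≤s (ℕₚ.m∸n≤m r k)))) (≈-reflexive last) ⟩
      ∑ r (λ _ → 1ℚ) + 0ℚ ≡⟨ trans (+-identityʳ _) (∑-const-1 r) ⟩
      ℕ→ℚ r ≡⟨ solve 1 (λ a → a := con 1ℚ :+ a :+ con (- 1ℚ)) refl (ℕ→ℚ r) ⟩
      1ℚ + ℕ→ℚ r - 1ℚ ≡⟨ cong (_- 1ℚ) (trans (sym P≡1+r) (sym (*-identityʳ P))) ⟩
      P * 1ℚ - 1ℚ ≈⟨ +-≈ (P*≈0 1-integral) (≈-refl { - 1ℚ}) ⟩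
      0ℚ - 1ℚ ≡⟨ refl ⟩
      - 1ℚ ∎
      where
      open ≈-Reasoning
      x : ℕ → ℚ
      x k = (0ℚ + ℕ→ℚ k) ^ℚ r
      x-integral : ∀ k → Integral (x k)
      x-integral k = ^-integral (+-integral 0-integral (ℕ-integral k)) r
      step : ∀ k → k < p → binom r k * ((- 1ℚ) ^ℚ k * x (r ∸ k)) ≈ x (r ∸ k)
      step k k<p = begin
        binom r k * ((- 1ℚ) ^ℚ k * x (r ∸ k))
          ≈⟨ *-≈ʳ (*-integral (^-integral (neg-integral 1-integral) k) (x-integral (r ∸ k))) (binom-r≈ k k<p) ⟩
        (- 1ℚ) ^ℚ k * ((- 1ℚ) ^ℚ k * x (r ∸ k)) ≡⟨ sym (*-assoc ((- 1ℚ) ^ℚ k) ((- 1ℚ) ^ℚ k) (x (r ∸ k))) ⟩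
        (- 1ℚ) ^ℚ k * (- 1ℚ) ^ℚ k * x (r ∸ k) ≡⟨ cong (_* x (r ∸ k)) (neg1-square k) ⟩
        1ℚ * x (r ∸ k) ≡⟨ *-identityˡ (x (r ∸ k)) ⟩
        x (r ∸ k) ∎
      unit : ∀ j → 0 < j → j < p → x j ≈ 1ℚ
      unit (suc j) _ j<p = ≈-trans (≈-reflexive (cong (_^ℚ r) (+-identityˡ (ℕ→ℚ (suc j))))) (fermat-unit j (p∤suc j<p))
      last : x (r ∸ r) ≡ 0ℚ
      last = trans (cong x (ℕₚ.n∸n≡0 r)) (*-zeroˡ (0ℚ ^ℚ s))

    [p-2]!≈1 : ℕ→ℚ (s !) ≈ 1ℚ
    [p-2]!≈1 = begin
      ℕ→ℚ (s !) ≡⟨ solve 2 (λ f r → f := :- (r :* f) :+ (con 1ℚ :+ r) :* f) refl F R ⟩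
      - (R * F) + (1ℚ + R) * F ≡⟨ cong₂ (λ a b → - a + b * F) (sym (ℕ→ℚ-* r (s !))) (sym P≡1+r) ⟩
      - ℕ→ℚ (r !) + P * F ≈⟨ +-≈ (neg-≈ wilson) (P*≈0 (ℕ-integral (s !))) ⟩
      1ℚ ∎
      where
      open ≈-Reasoning
      F R : ℚ
      F = ℕ→ℚ (s !)
      R = ℕ→ℚ r

    2^r≈1 : 2ℚ ^ℚ r ≈ 1ℚ
    2^r≈1 = fermat-unit 1 p∤2

    -- The Fermat quotient and the alternating count

    -- q is the Fermat quotient (2ᵖ⁻¹ - 1)/p.
    open _≈_ 2^r≈1 public renaming (quotient to q; quotient-integral to q-integral; equation to 2^r≡1+Pq)

    -- Division by p is sound for exact equations only, not for `_≈_`.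
    cancel-P : ∀ {x y} → P * x ≡ P * y → x ≡ y
    cancel-P {x} {y} e = trans (sym (inv-*-cancel r x)) (trans (cong (inv p *_) e) (inv-*-cancel r y))

    -- The inner entries of row p of Pascal's triangle add up to 2ᵖ - 2 = 2pq; by absorption each of
    -- them divided by p is a term of this sum.
    ∑-binom/suc : ∑ r (λ i → inv (suc i) * binom r i) ≡ 2ℚ * q
    ∑-binom/suc = cancel-P (begin
      P * ∑ r (λ i → inv (suc i) * binom r i) ≡⟨ sym (∑-*ˡ r P (λ i → inv (suc i) * binom r i)) ⟩
      ∑ r (λ i → P * (inv (suc i) * binom r i)) ≡⟨ ∑-cong r (λ i _ → sym (binom-suc-suc r i)) ⟩
      A ≡⟨ solve 1 (λ a → a := con 1ℚ :+ a :+ con 1ℚ :- con 2ℚ) refl A ⟩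
      1ℚ + A + 1ℚ - 2ℚ ≡⟨ cong₂ (λ a b → a + A + b - 2ℚ) (sym (binom-n-0 p)) (sym (binom-n-n p)) ⟩
      binom p 0 + A + binom p p - 2ℚ ≡⟨ cong (λ z → z + binom p p - 2ℚ) (sym (∑-head r (binom p))) ⟩
      ∑ (suc p) (binom p) - 2ℚ ≡⟨ cong (_- 2ℚ) (∑-binom p) ⟩
      2ℚ * 2ℚ ^ℚ r - 2ℚ ≡⟨ cong (λ z → 2ℚ * z - 2ℚ) 2^r≡1+Pq ⟩
      2ℚ * (1ℚ + P * q) - 2ℚ ≡⟨ solve 2 (λ p q → con 2ℚ :* (con 1ℚ :+ p :* q) :- con 2ℚ := p :* (con 2ℚ :* q)) refl P q ⟩
      P * (2ℚ * q) ∎)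
      where
      open ≡-Reasoning
      A : ℚ
      A = ∑ r (λ i → binom p (suc i))

    -- By Fermat a (p-2)-nd power is a reciprocal modulo p, so up to the factor 2 the terms are
    -- (-1)ᵏ⁻¹/(2k) with k = i + 1, and the sign is that of C(p-1,k-1).
    alternating-power-sum : 2ℚ * ∑ p (λ i → (- 1ℚ) ^ℚ i * (2ℚ * ℕ→ℚ (suc i)) ^ℚ s) ≈ 2ℚ * q
    alternating-power-sum = begin
      2ℚ * ∑ p t ≡⟨ sym (∑-*ˡ p 2ℚ t) ⟩
      ∑ r (λ i → 2ℚ * t i) + 2ℚ * t r ≈⟨ +-≈ (∑-≈ r step) last ⟩
      ∑ r (λ i → inv (suc i) * binom r i) + 0ℚ ≡⟨ trans (+-identityʳ _) ∑-binom/suc ⟩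
      2ℚ * q ∎
      where
      open ≈-Reasoning
      t : ℕ → ℚ
      t i = (- 1ℚ) ^ℚ i * (2ℚ * ℕ→ℚ (suc i)) ^ℚ s
      step : ∀ i → i < r → 2ℚ * t i ≈ inv (suc i) * binom r i
      step i i<r = begin
        2ℚ * (σ * y ^ℚ s) ≡⟨ solve 2 (λ a b → con 2ℚ :* (a :* b) := con 1ℚ :* (con 2ℚ :* (a :* b))) refl σ (y ^ℚ s) ⟩
        -- Inserting i + 1 times its reciprocal raises the exponent from p - 2 to p - 1, where
        -- Fermat applies.
        1ℚ * (2ℚ * (σ * y ^ℚ s)) ≡⟨ cong (_* (2ℚ * (σ * y ^ℚ s))) (sym (n*inv[n]≡1 i)) ⟩
        ℕ→ℚ (suc i) * v * (2ℚ * (σ * y ^ℚ s))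
          ≡⟨ solve 4 (λ n v s y → n :* v :* (con 2ℚ :* (s :* y)) := v :* (s :* ((con 2ℚ :* n) :* y))) refl (ℕ→ℚ (suc i)) v σ (y ^ℚ s) ⟩
        v * (σ * y ^ℚ r) ≡⟨ cong (λ z → v * (σ * z)) (^ℚ-distrib-* r 2ℚ (ℕ→ℚ (suc i))) ⟩
        v * (σ * (2ℚ ^ℚ r * ℕ→ℚ (suc i) ^ℚ r))
          ≈⟨ *-≈ˡ v-integral (*-≈ˡ σ-integral (≈-trans (*-≈ʳ (^-integral (ℕ-integral (suc i)) r) 2^r≈1)
                (*-≈ˡ 1-integral (fermat-unit i (p∤suc (s≤s i<r)))))) ⟩
        v * (σ * (1ℚ * 1ℚ)) ≡⟨ solve 2 (λ v s → v :* (s :* con 1ℚ) := v :* s) refl v σ ⟩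
        v * σ ≈⟨ *-≈ˡ v-integral (≈-sym (binom-r≈ i (ℕₚ.m<n⇒m<1+n i<r))) ⟩
        v * binom r i ∎
        where
        σ y v : ℚ
        σ = (- 1ℚ) ^ℚ i
        y = 2ℚ * ℕ→ℚ (suc i)
        v = inv (suc i)
        v-integral : Integral v
        v-integral = inv-integral (p∤suc (s≤s i<r))
        σ-integral : Integral σ
        σ-integral = ^-integral (neg-integral 1-integral) i
      -- The final base is 2p and its exponent `s` is `suc m`, so a factor p can be taken out.
      last : 2ℚ * t r ≈ 0ℚ
      last = ≈-trans (≈-reflexive (solve 3 (λ a p b → con 2ℚ :* (a :* ((con 2ℚ :* p) :* b)) := p :* (con 2ℚ :* (con 2ℚ :* (a :* b)))) refl ((- 1ℚ) ^ℚ r) P ((2ℚ * P) ^ℚ m)))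
        (P*≈0 (*-integral (ℕ-integral 2) (*-integral (ℕ-integral 2) (*-integral (^-integral (neg-integral 1-integral) r) (^-integral (*-integral (ℕ-integral 2) (ℕ-integral p)) m)))))

    -- The shift by p multiplies by the series with coefficients (2p)ʲ, which is 1 modulo p, so
    -- `alternating-shift` compares E with itself. As (-1)ᵖ = -1, the two copies add up to 2E
    -- instead of cancelling.
    tangent≈q : ∀ (E : ℕ → ℚ) → (∀ n → Integral (E n)) →
      (∀ n → conv E (2ℚ ^ℚ_) n + E n ≡ 2ℚ * 2ℚ ^ℚ n) → E s ≈ q
    tangent≈q E E-integral fun = *-cancelˡ-≈ {1} p∤2 (begin
      2ℚ * E s ≡⟨ solve 1 (λ e → con 2ℚ :* e := e :+ e) refl (E s) ⟩
      E s + E s ≈⟨ +-≈ (≈-refl {E s}) (≈-sym X≈E) ⟩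
      E s + X ≡⟨ cong (E s +_) X≡ ⟩
      E s + - (E s - 2ℚ * T) ≡⟨ solve 2 (λ e t → e :+ :- (e :- t) := t) refl (E s) (2ℚ * T) ⟩
      2ℚ * T ≈⟨ alternating-power-sum ⟩
      2ℚ * q ∎)
      where
      open ≈-Reasoning
      X T : ℚ
      X = conv E ((2ℚ * P) ^ℚ_) s
      T = ∑ p (λ i → (- 1ℚ) ^ℚ i * (2ℚ * ℕ→ℚ (suc i)) ^ℚ s)
      X≡ : X ≡ - (E s - 2ℚ * T)
      X≡ = trans (solve 1 (λ x → x := :- (con (- 1ℚ) :* con 1ℚ :* x)) refl X)
        (cong -_ (trans (cong (λ z → - 1ℚ * z * X) (sym neg1^r)) (alternating-shift E fun p s)))
      power : ∀ j → (2ℚ * P) ^ℚ j ≈ δ j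
      power zero    = ≈-refl
      power (suc j) = ≈-trans (≈-reflexive (solve 2 (λ p b → (con 2ℚ :* p) :* b := p :* (con 2ℚ :* b)) refl P ((2ℚ * P) ^ℚ j)))
        (P*≈0 (*-integral (ℕ-integral 2) (^-integral (*-integral (ℕ-integral 2) (ℕ-integral p)) j)))
      X≈E : X ≈ E s
      X≈E = ≈-trans (conv-≈ s E-integral power) (≈-reflexive (conv-identityʳ s E))

    -- The Bernoulli sum

    bernoulli-integral : ∀ n → suc n < p → ∀ k → k ≤ n → Integral (bernoulli k)
    bernoulli-integral n       _   zero    _   = 1-integral
    bernoulli-integral (suc n) n<p (suc k) (s≤s k≤n) with ℕₚ.m≤n⇒m<n∨m≡n k≤n
    ... | inj₁ k<n = bernoulli-integral n (ℕₚ.<-trans (ℕₚ.n<1+n (suc n)) n<p) (suc k) k<n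
    -- Computing Bₙ₊₁ divides by n + 2, which is less than p here. The bound ends at Bₚ₋₂; the next
    -- number would need division by p.
    ... | inj₂ refl = subst Integral (sym (bernoulli-suc n))
      (neg-integral (*-integral (inv-integral (p∤suc n<p))
        (∑-integral (suc n) (λ j j≤n → *-integral (binom-integral (suc (suc n)) j)
          (bernoulli-integral n (ℕₚ.<-trans (ℕₚ.n<1+n (suc n)) n<p) j (ℕₚ.≤-pred j≤n))))))

    S : ℚ
    S = ∑ s (λ k → divBernoulli (suc k) * inv (2 ℕ.^ suc k))

    -- The term of index k + 1 in the expansion of Bₚ(-2), divided by p.
    u : ℕ → ℚ
    u k = (inv (suc k) * binom r k) * (bernoulli (suc k) * (- 1ℚ - 1ℚ) ^ℚ (r ∸ k))

    -- Three terms leave the expansion of Bₚ(-2): index 0 turns fractional after division by p,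
    -- index p - 1 contains Bₚ₋₁, and Bₚ occurs on both sides and cancels, whatever its value.
    bernoulli-binomial-sum : P * ∑ s u ≡ P * (2ℚ * (inv p + q + bernoulli r - 1ℚ) + P * - q)
    bernoulli-binomial-sum = begin
      P * ∑ s u ≡⟨ sym (∑-*ˡ s P u) ⟩
      ∑ s (λ k → P * u k) ≡⟨ ∑-cong s (λ k _ → trans (sym (*-assoc P (inv (suc k) * binom r k) (bernoulli (suc k) * N ^ℚ (r ∸ k))))
                                 (cong (_* (bernoulli (suc k) * N ^ℚ (r ∸ k))) (sym (binom-suc-suc r k)))) ⟩
      A ≡⟨ solve 4 (λ a g h b → a := g :+ (a :+ h) :+ b :- b :- g :- h) refl A (g 0) (g r) (bernoulli p) ⟩
      g 0 + (A + g r) + bernoulli p - bernoulli p - g 0 - g r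
        ≡⟨ cong (λ z → z - bernoulli p - g 0 - g r) total ⟩
      bernoulli p - (P * (- 1ℚ) ^ℚ r + P * N ^ℚ r) - bernoulli p - g 0 - g r
        ≡⟨ cong₂ (λ a b → bernoulli p - (P * (- 1ℚ) ^ℚ r + P * N ^ℚ r) - bernoulli p - a - b) g0 gr ⟩
      bernoulli p - (P * (- 1ℚ) ^ℚ r + P * N ^ℚ r) - bernoulli p - N * N ^ℚ r - P * (bernoulli r * N)
        ≡⟨ cong₂ (λ a b → bernoulli p - (P * a + P * b) - bernoulli p - N * b - P * (bernoulli r * N)) neg1^r N^r ⟩
      bernoulli p - (P * 1ℚ + P * (1ℚ + P * q)) - bernoulli p - N * (1ℚ + P * q) - P * (bernoulli r * N)
        ≡⟨ solve 4 (λ b p q c → b :- (p :* con 1ℚ :+ p :* (con 1ℚ :+ p :* q)) :- b :- con N :* (con 1ℚ :+ p :* q) :- p :* (c :* con N)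
               := con 2ℚ :* con 1ℚ :+ p :* (con 2ℚ :* (q :+ c :- con 1ℚ) :+ p :* (:- q))) refl (bernoulli p) P q (bernoulli r) ⟩
      -- The leftover 2 comes from (-2)ᵖ = -2(1 + pq). Writing its factor 1 as p times 1/p produces
      -- the 1/p of the Agoh-Giuga quotient.
      2ℚ * 1ℚ + P * (2ℚ * (q + bernoulli r - 1ℚ) + P * - q)
        ≡⟨ cong (λ z → 2ℚ * z + P * (2ℚ * (q + bernoulli r - 1ℚ) + P * - q)) (sym (n*inv[n]≡1 r)) ⟩
      2ℚ * (P * inv p) + P * (2ℚ * (q + bernoulli r - 1ℚ) + P * - q)
        ≡⟨ solve 4 (λ p i q c → con 2ℚ :* (p :* i) :+ p :* (con 2ℚ :* (q :+ c :- con 1ℚ) :+ p :* (:- q))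
               := p :* (con 2ℚ :* (i :+ q :+ c :- con 1ℚ) :+ p :* (:- q))) refl P (inv p) q (bernoulli r) ⟩
      P * (2ℚ * (inv p + q + bernoulli r - 1ℚ) + P * - q) ∎
      where
      open ≡-Reasoning
      N : ℚ
      N = - 1ℚ - 1ℚ
      g : ℕ → ℚ
      g k = binom p k * (bernoulli k * N ^ℚ (p ∸ k))
      A : ℚ
      A = ∑ s (g ∘ suc)
      total : g 0 + (A + g r) + bernoulli p ≡ bernoulli p - (P * (- 1ℚ) ^ℚ r + P * N ^ℚ r)
      total = begin
        g 0 + (A + g r) + bernoulli p ≡⟨ cong₂ _+_ (sym (∑-head r g)) (sym gp) ⟩
        ∑ p g + g p ≡⟨ sym (conv≡∑ p bernoulli (N ^ℚ_)) ⟩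
        conv bernoulli (N ^ℚ_) p ≡⟨ bernoulli-at-2 r ⟩
        bernoulli p - (P * (- 1ℚ) ^ℚ r + P * N ^ℚ r) ∎
        where
        gp : g p ≡ bernoulli p
        gp = trans (cong₂ (λ a b → a * (bernoulli p * N ^ℚ b)) (binom-n-n p) (ℕₚ.n∸n≡0 p))
          (solve 1 (λ b → con 1ℚ :* (b :* con 1ℚ) := b) refl (bernoulli p))
      g0 : g 0 ≡ N * N ^ℚ r
      g0 = trans (cong (_* (1ℚ * N ^ℚ p)) (binom-n-0 p)) (trans (*-identityˡ (1ℚ * N ^ℚ p)) (*-identityˡ (N ^ℚ p)))
      gr : g r ≡ P * (bernoulli r * N)
      gr = cong₂ (λ a b → a * (bernoulli r * N ^ℚ b)) (binom-suc-n r) (ℕₚ.m+n∸n≡m 1 r)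
      N^r : N ^ℚ r ≡ 1ℚ + P * q
      N^r = trans (^ℚ-distrib-* r (- 1ℚ) 2ℚ) (trans (cong₂ _*_ neg1^r 2^r≡1+Pq) (*-identityˡ (1ℚ + P * q)))

    ∤2^ : ∀ n → ¬ p ∣ 2 ℕ.^ n
    ∤2^ zero    = p∤1
    ∤2^ (suc n) = p∤* {2} {2 ℕ.^ n} p∤2 (∤2^ n)

    inv-cancel : ∀ n → ¬ p ∣ n → ℕ→ℚ n * inv n ≡ 1ℚ
    inv-cancel (suc n) _   = n*inv[n]≡1 n
    inv-cancel zero    p∤0 with () ← p∤0 (p ∣0)

    -- The binomial sign and the sign of the power combine to (-1)ᵖ⁻¹ = 1. The power 2ᵖ⁻¹⁻ᵏ is 2ᵖ⁻¹
    -- times 2/2ᵏ⁺¹, which Fermat reduces to 2/2ᵏ⁺¹.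
    u≈ : ∀ k → k < s → u k ≈ 2ℚ * (divBernoulli (suc k) * inv (2 ℕ.^ suc k))
    u≈ k k<s = begin
      (i * binom r k) * (b * (- 1ℚ - 1ℚ) ^ℚ j) ≡⟨ cong (λ z → (i * binom r k) * (b * z)) (^ℚ-distrib-* j (- 1ℚ) 2ℚ) ⟩
      (i * binom r k) * (b * ((- 1ℚ) ^ℚ j * 2ℚ ^ℚ j))
        ≡⟨ solve 5 (λ i c b x y → (i :* c) :* (b :* (x :* y)) := (b :* i) :* (c :* (x :* y))) refl i (binom r k) b ((- 1ℚ) ^ℚ j) (2ℚ ^ℚ j) ⟩
      (b * i) * (binom r k * ((- 1ℚ) ^ℚ j * 2ℚ ^ℚ j))
        ≈⟨ *-≈ˡ bi-integral (*-≈ʳ (*-integral (^-integral (neg-integral 1-integral) j) (^-integral (ℕ-integral 2) j)) (binom-r≈ k k<p)) ⟩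
      (b * i) * ((- 1ℚ) ^ℚ k * ((- 1ℚ) ^ℚ j * 2ℚ ^ℚ j))
        ≡⟨ cong ((b * i) *_) (trans (sym (*-assoc ((- 1ℚ) ^ℚ k) _ _)) (trans (cong (_* 2ℚ ^ℚ j) (trans (split (- 1ℚ)) neg1^r)) (*-identityˡ (2ℚ ^ℚ j)))) ⟩
      (b * i) * 2ℚ ^ℚ j ≡⟨ cong ((b * i) *_) 2^j ⟩
      (b * i) * (2ℚ ^ℚ r * (2ℚ * w)) ≈⟨ *-≈ˡ bi-integral (*-≈ʳ (*-integral (ℕ-integral 2) w-integral) 2^r≈1) ⟩
      (b * i) * (1ℚ * (2ℚ * w)) ≡⟨ solve 3 (λ b i w → (b :* i) :* (con 1ℚ :* (con 2ℚ :* w)) := con 2ℚ :* (b :* i :* w)) refl b i w ⟩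
      2ℚ * (b * i * w) ∎
      where
      open ≈-Reasoning
      j : ℕ
      j = r ∸ k
      b i w : ℚ
      b = bernoulli (suc k)
      i = inv (suc k)
      w = inv (2 ℕ.^ suc k)
      k<p : k < p
      k<p = ℕₚ.m<n⇒m<1+n (ℕₚ.m<n⇒m<1+n k<s)
      bi-integral : Integral (b * i)
      bi-integral = *-integral (bernoulli-integral (suc k) (s≤s (s≤s k<s)) (suc k) ℕₚ.≤-refl)
        (inv-integral (p∤suc (s≤s (ℕₚ.m<n⇒m<1+n k<s))))
      w-integral : Integral w
      w-integral = inv-integral (∤2^ (suc k))
      split : ∀ x → x ^ℚ k * x ^ℚ j ≡ x ^ℚ r
      split x = trans (sym (^ℚ-+ k j x)) (cong (x ^ℚ_) (ℕₚ.m+[n∸m]≡n (ℕₚ.<⇒≤ (ℕₚ.m<n⇒m<1+n k<s))))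
      2^j : 2ℚ ^ℚ j ≡ 2ℚ ^ℚ r * (2ℚ * w)
      2^j = ≡.begin
        2ℚ ^ℚ j ≡.≡⟨ sym (*-identityʳ (2ℚ ^ℚ j)) ⟩
        2ℚ ^ℚ j * 1ℚ ≡.≡⟨ cong (2ℚ ^ℚ j *_) (sym (inv-cancel (2 ℕ.^ suc k) (∤2^ (suc k)))) ⟩
        2ℚ ^ℚ j * (ℕ→ℚ (2 ℕ.^ suc k) * w) ≡.≡⟨ cong (λ z → 2ℚ ^ℚ j * (z * w)) (ℕ→ℚ-^ 2 (suc k)) ⟩
        2ℚ ^ℚ j * ((2ℚ * 2ℚ ^ℚ k) * w)
          ≡.≡⟨ solve 3 (λ a b w → a :* ((con 2ℚ :* b) :* w) := (b :* a) :* (con 2ℚ :* w)) refl (2ℚ ^ℚ j) (2ℚ ^ℚ k) w ⟩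
        (2ℚ ^ℚ k * 2ℚ ^ℚ j) * (2ℚ * w) ≡.≡⟨ cong (_* (2ℚ * w)) (split 2ℚ) ⟩
        2ℚ ^ℚ r * (2ℚ * w) ≡.∎
        where module ≡ = ≡-Reasoning

    S≈ : S ≈ inv p + q + bernoulli r - 1ℚ
    S≈ = *-cancelˡ-≈ {1} p∤2 (begin
      2ℚ * S ≡⟨ sym (∑-*ˡ s 2ℚ (λ k → divBernoulli (suc k) * inv (2 ℕ.^ suc k))) ⟩
      ∑ s (λ k → 2ℚ * (divBernoulli (suc k) * inv (2 ℕ.^ suc k))) ≈⟨ ∑-≈ s (λ k k<s → ≈-sym (u≈ k k<s)) ⟩
      -- The trailing `P * - q` of the exact identity is the multiple of p that the congruence
      -- discards, with witness -q.
      ∑ s u ≈⟨ congruent (neg-integral q-integral) (cancel-P bernoulli-binomial-sum) ⟩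
      2ℚ * (inv p + q + bernoulli r - 1ℚ) ∎)
      where open ≈-Reasoning

open Exact
open Modular
open import Data.Bool using (true; false)
open import Data.Nat using (ℕ; zero; suc; _∸_; _^_; _+_; _*_; _!)
open import Data.Nat.Divisibility using (_∣_; _∣0; ∣m∣n⇒∣m+n; ∣-refl)
open import Data.Nat.Primality using (Prime; ¬prime[0]; ¬prime[1]; prime⇒irreducible)
import Data.Nat.Properties as ℕₚ
open import Data.Fin using (toℕ)
open import Data.Sum using (inj₁; inj₂)
open import Data.Rational using (ℚ; 1ℚ; -_; _-_) renaming (_+_ to _+ℚ_; _*_ to _*ℚ_)
import Data.Rational.Properties as ℚₚ
open import Data.Rational.Solver using (module +-*-Solver)
open import Relation.Nullary using (contradiction)
open +-*-Solver using (solve; _:+_; _:*_; _:-_; _:=_; con)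

-- Parity and conclusion

isEven⇒2∣ : ∀ n → isEven n ≡ true → 2 ∣ n
isEven⇒2∣ zero          _ = 2 ∣0
isEven⇒2∣ (suc (suc n)) e = ∣m∣n⇒∣m+n ∣-refl (isEven⇒2∣ n e)

isEven-suc : ∀ n → isEven n ≡ false → isEven (suc n) ≡ true
isEven-suc (suc zero)    _ = refl
isEven-suc (suc (suc n)) e = isEven-suc n e

-- For odd m the number 3 + m would have the divisor 2, which is neither 1 nor 3 + m.
odd-prime⇒even : ∀ m → Prime (3 + m) → isEven m ≡ true
odd-prime⇒even m p-prime with isEven m in eq
... | true  = refl
... | false with prime⇒irreducible p-prime (isEven⇒2∣ (3 + m) (isEven-suc m eq))
... | inj₁ ()
... | inj₂ ()

even⇒neg1^≡1 : ∀ m → isEven m ≡ true → (- 1ℚ) ^ℚ m ≡ 1ℚ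
even⇒neg1^≡1 m e = trans (solve 1 (λ x → x := con 1ℚ :+ x :- con 1ℚ) refl ((- 1ℚ) ^ℚ m))
  (cong (_- 1ℚ) (trans (sym (1+neg1^ m)) (cong (λ b → 2ℚ *ℚ 𝟙 b) e)))

module Final (m : ℕ) (p-prime : Prime (3 + m)) where

  open OddPrime m p-prime (even⇒neg1^≡1 m (odd-prime⇒even m p-prime)) public

  ascentSum-integral : ∀ n k → Integral (ascentSum (- 1ℚ) n k)
  ascentSum-integral zero    k = 1-integral
  ascentSum-integral (suc n) k = +-integral
    (*-integral (neg-integral 1-integral) (∑-integral (suc n) (λ j _ → ascentSum-integral n j)))
    (*-integral (ℕ-integral 2) (∑-integral k (λ j _ → ascentSum-integral n j)))

  2M≈ : ℕ→ℚ (2 * M s) ≈ q - 1ℚ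
  2M≈ = begin
    ℕ→ℚ (2 * M s) ≡⟨ ℕ→ℚ-* 2 (M s) ⟩
    2ℚ *ℚ ℕ→ℚ (M s) ≡⟨ solve 1 (λ x → x := x :+ con 2ℚ :- con 2ℚ) refl (2ℚ *ℚ ℕ→ℚ (M s)) ⟩
    2ℚ *ℚ ℕ→ℚ (M s) +ℚ 2ℚ - 2ℚ ≡⟨ cong (_- 2ℚ) (2M+2 m (odd-prime⇒even m p-prime)) ⟩
    ℕ→ℚ (s !) +ℚ altEulerian s - 2ℚ
      ≈⟨ +-≈ (+-≈ [p-2]!≈1 (tangent≈q altEulerian (λ n → ascentSum-integral n n) altEulerian-functional)) (≈-refl { - 2ℚ}) ⟩
    1ℚ +ℚ q - 2ℚ ≡⟨ solve 1 (λ x → con 1ℚ :+ x :- con 2ℚ := x :- con 1ℚ) refl q ⟩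
    q - 1ℚ ∎
    where open ≈-Reasoning

  agohGiuga≡ : agohGiuga p ≡ inv p +ℚ bernoulli r
  agohGiuga≡ = trans (solve 3 (λ p b i → (p :* b :+ con 1ℚ) :* i := i :+ (p :* i) :* b) refl P (bernoulli r) (inv p))
    (cong (inv p +ℚ_) (trans (cong (_*ℚ bernoulli r) (n*inv[n]≡1 r)) (ℚₚ.*-identityˡ (bernoulli r))))

  result : ΣFin s (λ k → divBernoulli (toℕ k + 1) *ℚ inv (2 ^ (toℕ k + 1))) ≈ agohGiuga p +ℚ ℕ→ℚ (2 * M s)
  result = begin
    ΣFin s (λ k → divBernoulli (toℕ k + 1) *ℚ inv (2 ^ (toℕ k + 1)))
      ≡⟨ ΣFin-cong s (λ k → cong (λ n → divBernoulli n *ℚ inv (2 ^ n)) (ℕₚ.+-comm (toℕ k) 1)) ⟩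
    ΣFin s (λ k → divBernoulli (suc (toℕ k)) *ℚ inv (2 ^ suc (toℕ k)))
      ≡⟨ ΣFin≡∑ s (λ k → divBernoulli (suc k) *ℚ inv (2 ^ suc k)) ⟩
    S ≈⟨ S≈ ⟩
    inv p +ℚ q +ℚ bernoulli r - 1ℚ
      ≡⟨ solve 3 (λ i q b → i :+ q :+ b :- con 1ℚ := (i :+ b) :+ (q :- con 1ℚ)) refl (inv p) q (bernoulli r) ⟩
    (inv p +ℚ bernoulli r) +ℚ (q - 1ℚ) ≈⟨ +-≈ (≈-reflexive (sym agohGiuga≡)) (≈-sym 2M≈) ⟩
    agohGiuga p +ℚ ℕ→ℚ (2 * M s) ∎
    where open ≈-Reasoning

mainTheorem1 : (p : ℕ) → Prime p → p ≢ 2 →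
    ΣFin (p ∸ 2) (λ k → divBernoulli (toℕ k + 1) *ℚ inv (2 ^ (toℕ k + 1)))
    ≡ agohGiuga p +ℚ ℕ→ℚ (2 * M (p ∸ 2)) [modℚ p ]
mainTheorem1 0 p-prime _   = contradiction p-prime ¬prime[0]
mainTheorem1 1 p-prime _   = contradiction p-prime ¬prime[1]
mainTheorem1 2 _       p≢2 = contradiction refl p≢2
mainTheorem1 (suc (suc (suc m))) p-prime _ = ≈⇒modℚ result
  where open Final m p-prime
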